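{- Let $p$ be a prime, let $K\subset\mathbb{Q}_p$ be a field with $[K:\mathbb{Q}]=2$, let $z\in K$ satisfy condition (H) with $K=\mathbb{Q}(z)$, and let $\epsilon\in\{ -1,1\}$. Let $T=T_{\epsilon,z}:K\to K$ be the map defined in the context. Then every rational number $\alpha$ has a finite expansion (i.e. $T^m(\alpha)=0$ for some $m\ge 0$), and every $\alpha\in K$ with $\alpha\notin\mathbb{Q}$ has a periodic expansion (i.e. $T^{m_1}(\alpha)=T^{m_2}(\alpha)$ for some integers $0\le m_1<m_2$).
   Context: Notation: For $\beta\in\mathbb{Q}_p\setminus\{0\}$ write $\beta=\sum_{n\in\mathbb{Z}}c_np^n$ with digits $c_n\in\{0,1,\dots,p-1\}$; $\mathrm{ord}_p(\beta)=\min\{n: c_n\neq 0\}$ ($\mathrm{ord}_p(0)=\infty$), $\omega_p(\beta):=c_0$ ($\omega_p(0)=0$), and $\langle\beta\rangle_p:=\sum_{n\ge 1}c_np^n$ ($\langle 0\rangle_p=0$). Condition (H): an element $\beta\in\mathbb{Q}_p$, algebraic over $\mathbb{Q}$, with $\beta\notin\mathbb{Q}$ and $\beta\in p\mathbb{Z}_p$, satisfies (H) if its minimal polynomial over $\mathbb{Q}$ is $x^n+a_1x^{n-1}+\dots+a_n$ with all $a_i\in\mathbb{Z}_p\cap\mathbb{Q}$, $\mathrm{ord}_p(a_{n-1})=0$ and $\mathrm{ord}_p(a_n)>0$. The map $T=T_{\epsilon,z}$ (the one-dimensional $\Phi_1^{[\epsilon,z]}$ algorithm): for $\alpha\in K$,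 put $g=\frac{\epsilon p^{\mathrm{ord}_p(\alpha)}}{\alpha}-\omega_p\!\left(\frac{\epsilon p^{\mathrm{ord}_p(\alpha)}}{\alpha}\right)$ if $\alpha\neq0$ and $g=0$ if $\alpha=0$. Write uniquely $g=a_0+a_1z$ with $a_0,a_1\in\mathbb{Q}$, let $a'$ be the largest positive integer coprime to $p$ dividing the numerator of $a_1$ (with $a'=1$ if $a_1=0$), and set $T(\alpha):=\frac{g}{a'}-\left\langle\frac{a_0}{a'}\right\rangle_p$. The expansion of $\alpha$ is the sequence $\alpha^{(0)}=\alpha$, $\alpha^{(n+1)}=T(\alpha^{(n)})$. -}

module Defs where

open import Data.Nat as ℕ using (ℕ; zero; suc; _<_; _≤_; _^_)
open import Data.Nat.Divisibility using (_∣_)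
open import Data.Nat.Coprimality using (Coprime)
open import Data.Integer as ℤ using (ℤ; +_; -[1+_]; ∣_∣)
open import Data.Rational as ℚ using (ℚ; ↥_; ↧ₙ_; 0ℚ)
open import Data.Product using (Σ; _×_; _,_; proj₁; proj₂)
open import Data.Sum using (_⊎_)
open import Relation.Nullary using (¬_)
open import Relation.Binary.PropositionalEquality using (_≡_; _≢_)

ℕ→ℚ : ℕ → ℚ
ℕ→ℚ n = + n ℚ./ 1

iter : {A : Set} → (A → A) → ℕ → A → A
iter f zero x = x
iter f (suc n) x = f (iter f n x)

-- The quadratic field K = ℚ(z): the element a₀ + a₁ z is the pair (a₀ , a₁).
K : Set
K = ℚ × ℚ

0K : K
0K = 0ℚ , 0ℚ

ι : ℚ → K
ι q = q , 0ℚ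

-- Irreducibility over ℚ of the monic quadratic x² + b x + c:
-- it does not factor as (x - r)(x - s) with r, s ∈ ℚ.
IrreducibleQuad : ℚ → ℚ → Set
IrreducibleQuad b c = ¬ (Σ ℚ λ r → Σ ℚ λ s → (b ≡ ℚ.- (r ℚ.+ s)) × (c ≡ r ℚ.* s))

module Setup (p : ℕ) (b c : ℚ) (d : ℕ → ℕ) (ε : ℚ) where
  -- z has p-adic digits d 0, d 1, ...; min. polynomial x² + b x + c, so z² = - b z - c.

  _+K_ : K → K → K
  (a₀ , a₁) +K (b₀ , b₁) = (a₀ ℚ.+ b₀) , (a₁ ℚ.+ b₁)

  _-K_ : K → K → K
  (a₀ , a₁) -K (b₀ , b₁) = (a₀ ℚ.- b₀) , (a₁ ℚ.- b₁)

  _*K_ : K → K → K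
  (a₀ , a₁) *K (b₀ , b₁) =
    (a₀ ℚ.* b₀ ℚ.- c ℚ.* (a₁ ℚ.* b₁)) ,
    (a₀ ℚ.* b₁ ℚ.+ a₁ ℚ.* b₀ ℚ.- b ℚ.* (a₁ ℚ.* b₁))

  scaleK : ℚ → K → K
  scaleK q (a₀ , a₁) = (q ℚ.* a₀) , (q ℚ.* a₁)

  pℚ : ℚ
  pℚ = ℕ→ℚ p

  PIntegral : ℚ → Set
  PIntegral q = ¬ (p ∣ ↧ₙ q)

  DivQ : ℕ → ℚ → Set
  DivQ k q = PIntegral q × ((p ^ k) ∣ ∣ ↥ q ∣)

  Ztr : ℕ → ℕ
  Ztr zero = 0
  Ztr (suc k) = Ztr k ℕ.+ d k ℕ.* p ^ k

  Zq : ℕ → ℚ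
  Zq k = ℕ→ℚ (Ztr k)

  IsRoot : Set
  IsRoot = ∀ k → DivQ k (Zq k ℚ.* Zq k ℚ.+ b ℚ.* Zq k ℚ.+ c)

  -- a₀ + a₁ z ∈ ℤ_p  (with D the product of denominators, D a₀ + D a₁ z ∈ D ℤ_p)
  InZp : K → Set
  InZp (a₀ , a₁) =
    let D = ↧ₙ a₀ ℕ.* ↧ₙ a₁ in
    ∀ k → (p ^ k) ∣ D →
      DivQ k (ℕ→ℚ D ℚ.* a₀ ℚ.+ ℕ→ℚ D ℚ.* a₁ ℚ.* Zq k)

  InpZp : K → Set
  InpZp β = Σ K λ γ → (β ≡ scaleK pℚ γ) × InZp γ

  EqPow : ℤ → K → K → Set
  EqPow (+ n) α β = α ≡ scaleK (ℕ→ℚ (p ^ n)) β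
  EqPow -[1+ n ] α β = scaleK (ℕ→ℚ (p ^ suc n)) α ≡ β

  Ord : K → ℤ → Set
  Ord α v = Σ K λ β → EqPow v α β × InZp β × ¬ InpZp β

  Omega : K → ℕ → Set
  Omega x w = (w < p) × InpZp (x -K ι (ℕ→ℚ w))

  -- s = Σ_{n ≤ 0} c_n p^n for the rational q, so ⟨q⟩_p = q - s
  FracPart : ℚ → ℚ → Set
  FracPart q s = Σ ℕ λ j → Σ ℕ λ m →
    (s ℚ.* (ℕ→ℚ (p ^ j)) ≡ ℕ→ℚ m) × (m < p ^ suc j) × DivQ 1 (q ℚ.- s)

  LargestCoprime : ℚ → ℕ → Set
  LargestCoprime a₁ a' =
    (a₁ ≡ 0ℚ × a' ≡ 1) ⊎
    (a₁ ≢ 0ℚ × 1 ≤ a' × Coprime a' p × a' ∣ ∣ ↥ a₁ ∣ ×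
      (∀ e → 1 ≤ e → Coprime e p → e ∣ ∣ ↥ a₁ ∣ → e ≤ a'))

  TSpec : K → K → Set
  TSpec α β =
    (α ≡ 0K × β ≡ 0K) ⊎
    (α ≢ 0K × Σ ℤ λ v → Σ K λ x → Σ ℕ λ w → Σ ℕ λ a' → Σ ℚ λ q → Σ ℚ λ s →
      Ord α v ×
      EqPow v (x *K α) (ι ε) ×          -- x = ε p^{ord α} / α
      Omega x w ×
      LargestCoprime (proj₂ (x -K ι (ℕ→ℚ w))) a' ×
      (q ℚ.* ℕ→ℚ a' ≡ proj₁ (x -K ι (ℕ→ℚ w))) ×
      FracPart q s ×
      -- β = g / a' - ⟨q⟩_p  with  ⟨q⟩_p = q - s
      (scaleK (ℕ→ℚ a') (β +K ι (q ℚ.- s)) ≡ x -K ι (ℕ→ℚ w)))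

{-# OPTIONS --safe #-}

-- Write the image of an irrational element under T as s + t z; it lies in p ℤ_p, and s, having only
-- digits of index ≤ 0, vanishes as soon as t is p-integral. If x = ε pᵛ / α with α = s + t z such
-- an image, then x = x₁ (b + 2z − α / t), where x and the bracket are p-adic units (α / t ∈ p ℤ_p
-- and b is a unit), so x₁ is a unit. Hence from the second step on the orbit consists of elements
-- tᵢ z with tᵢ = ±1 / eᵢ, eᵢ ∈ ℕ prime to p, and ± c aᵢ = pⁿ eᵢ eᵢ₊₁, where aᵢ is the integer a' of
-- the i-th step, coprime to eᵢ₊₁. It follows that eᵢ₊₁ divides the numerator of c, then that aᵢ is
-- the denominator of c, so that tᵢ tᵢ₊₁ does not depend on i and tᵢ₊₂ = tᵢ.
module Submission where

open import Defs
open import Data.Nat as ℕ using (ℕ; zero; suc; _<_; _≤_; _^_)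
import Data.Nat.Properties as ℕ
open import Data.Nat.Coprimality as Coprime using (Coprime; coprime-divisor)
open import Data.Nat.Divisibility as ℕ using (_∣_; divides; _∣?_)
open import Data.Nat.Induction using (<-rec)
open import Data.Nat.Solver renaming (module +-*-Solver to ℕ-Solver)
open import Data.Nat.Primality using (Prime; euclidsLemma; prime⇒irreducible; prime⇒nonZero; prime⇒nonTrivial)
open import Data.Integer as ℤ using (ℤ; +_; ∣_∣)
import Data.Integer.Divisibility.Signed as ℤ
import Data.Integer.Properties as ℤ
open import Data.Rational using (ℚ; mkℚ; ↥_; ↧_; ↧ₙ_; 0ℚ; 1ℚ; -_; _+_; _*_; _-_; _/_; 1/_; toℚᵘ; ≢-nonZero)
open import Data.Rational.Properties using (_≟_; +-identityʳ; +-inverseʳ; *-identityʳ; *-identityˡ; *-zeroˡ; *-zeroʳ; *-comm; *-assoc; *-inverseˡ; ↥p/↧p≡p; ↥p≡0⇒p≡0; toℚᵘ-injective; toℚᵘ-homo-*; toℚᵘ-fromℚᵘ)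
open import Data.Rational.Solver using (module +-*-Solver)
open import Data.Rational.Unnormalised as ℚᵘ using (mkℚᵘ; *≡*)
import Data.Rational.Unnormalised.Properties as ℚᵘ
open import Data.Product using (Σ; _×_; _,_; proj₁; proj₂)
open import Data.Sum using (_⊎_; inj₁; inj₂)
open import Function using (_∘_)
open import Relation.Nullary using (¬_; Dec; yes; no; contradiction)
open import Relation.Binary.PropositionalEquality using (_≡_; _≢_; refl; sym; trans; cong; cong₂; subst; module ≡-Reasoning)

open +-*-Solver using (solve; _:+_; _:*_; _:-_; :-_; _:=_; con)
open ℕ-Solver using () renaming (solve to ℕ-solve; _:*_ to _:*ℕ_; _:=_ to _:=ℕ_)

-- Integers and naturals inside ℚ.

ℤ→ℚ : ℤ → ℚ
ℤ→ℚ m = m / 1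

-- `m / 1` passes through a gcd normalisation that is stuck on a variable; the explicit constructor
-- form exposes the numerator and lets ring operations compute.
ℤ→ℚ≡mkℚ : ∀ m → ℤ→ℚ m ≡ mkℚ m 0 (Coprime.sym (Coprime.1-coprimeTo _))
ℤ→ℚ≡mkℚ m = ↥p/↧p≡p (mkℚ m 0 (Coprime.sym (Coprime.1-coprimeTo _)))

ℤ→ℚ-injective : ∀ {m n} → ℤ→ℚ m ≡ ℤ→ℚ n → m ≡ n
ℤ→ℚ-injective {m} {n} eq =
  cong ↥_ (trans (sym (ℤ→ℚ≡mkℚ m)) (trans eq (ℤ→ℚ≡mkℚ n)))

ℤ→ℚ-homo-+ : ∀ m n → ℤ→ℚ (m ℤ.+ n) ≡ ℤ→ℚ m + ℤ→ℚ n
ℤ→ℚ-homo-+ m n rewrite ℤ→ℚ≡mkℚ m | ℤ→ℚ≡mkℚ n =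
  cong (_/ 1) (sym (cong₂ ℤ._+_ (ℤ.*-identityʳ m) (ℤ.*-identityʳ n)))

ℤ→ℚ-homo-* : ∀ m n → ℤ→ℚ (m ℤ.* n) ≡ ℤ→ℚ m * ℤ→ℚ n
ℤ→ℚ-homo-* m n rewrite ℤ→ℚ≡mkℚ m | ℤ→ℚ≡mkℚ n = refl

ℕ→ℚ-homo-+ : ∀ m n → ℕ→ℚ (m ℕ.+ n) ≡ ℕ→ℚ m + ℕ→ℚ n
ℕ→ℚ-homo-+ m n = ℤ→ℚ-homo-+ (+ m) (+ n)

ℕ→ℚ-homo-* : ∀ m n → ℕ→ℚ (m ℕ.* n) ≡ ℕ→ℚ m * ℕ→ℚ n
ℕ→ℚ-homo-* m n = trans (cong ℤ→ℚ (ℤ.pos-* m n)) (ℤ→ℚ-homo-* (+ m) (+ n))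

-- Checked on unnormalised rationals, where equality is cross-multiplication and no gcd intervenes.
q*↧q≡↥q : ∀ q → q * ℤ→ℚ (↧ q) ≡ ℤ→ℚ (↥ q)
q*↧q≡↥q q@(mkℚ n d-1 _) = toℚᵘ-injective (begin
  toℚᵘ (q * ℤ→ℚ (↧ q))              ≈⟨ toℚᵘ-homo-* q (ℤ→ℚ (↧ q)) ⟩
  toℚᵘ q ℚᵘ.* toℚᵘ (ℤ→ℚ (↧ q))      ≈⟨ ℚᵘ.*-congˡ {toℚᵘ q} (toℚᵘ-fromℚᵘ (mkℚᵘ (↧ q) 0)) ⟩
  toℚᵘ q ℚᵘ.* mkℚᵘ (↧ q) 0          ≈⟨ *≡* (trans (ℤ.*-identityʳ _) (cong (λ e → n ℤ.* + suc e) (sym (ℕ.*-identityʳ d-1)))) ⟩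
  mkℚᵘ (↥ q) 0                      ≈⟨ toℚᵘ-fromℚᵘ (mkℚᵘ (↥ q) 0) ⟨
  toℚᵘ (ℤ→ℚ (↥ q))                  ∎)
  where open ℚᵘ.≃-Reasoning

↥↧-coprime : ∀ q → Coprime ∣ ↥ q ∣ (↧ₙ q)
↥↧-coprime (mkℚ _ _ c) = Coprime.recompute c

ℕ→ℚ≢0 : ∀ n → n ≢ 0 → ℕ→ℚ n ≢ 0ℚ
ℕ→ℚ≢0 n n≢0 eq = n≢0 (cong ∣_∣ (ℤ→ℚ-injective {+ n} {+ 0} eq))

*-cancelˡ-≢0 : ∀ {q r s} → q ≢ 0ℚ → q * r ≡ q * s → r ≡ s
*-cancelˡ-≢0 {q} {r} {s} q≢0 eq = begin
  r                ≡⟨ undo r ⟨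
  1/ q * (q * r)   ≡⟨ cong (1/ q *_) eq ⟩
  1/ q * (q * s)   ≡⟨ undo s ⟩
  s                ∎
  where
  open ≡-Reasoning
  instance _ = ≢-nonZero q≢0
  undo : ∀ u → 1/ q * (q * u) ≡ u
  undo u = trans (sym (*-assoc (1/ q) q u)) (trans (cong (_* u) (*-inverseˡ q)) (*-identityˡ u))

*-cancelʳ-≢0 : ∀ {q r s} → q ≢ 0ℚ → r * q ≡ s * q → r ≡ s
*-cancelʳ-≢0 {q} {r} {s} q≢0 eq = *-cancelˡ-≢0 q≢0 (trans (*-comm q r) (trans eq (*-comm s q)))

q*r≡0⇒r≡0 : ∀ {q r} → q ≢ 0ℚ → q * r ≡ 0ℚ → r ≡ 0ℚ
q*r≡0⇒r≡0 {q} q≢0 eq = *-cancelˡ-≢0 q≢0 (trans eq (sym (*-zeroʳ q)))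

*-≢0 : ∀ {q r} → q ≢ 0ℚ → r ≢ 0ℚ → q * r ≢ 0ℚ
*-≢0 q≢0 r≢0 eq = r≢0 (q*r≡0⇒r≡0 q≢0 eq)

-- Divisibility by powers of `p` in ℕ and in ℚ.

module Valuation (p : ℕ) (p-prime : Prime p) where

  p≢0 : p ≢ 0
  p≢0 = ℕ.≢-nonZero⁻¹ p {{prime⇒nonZero p-prime}}

  p^k≢0 : ∀ k → p ^ k ≢ 0
  p^k≢0 k = p≢0 ∘ ℕ.m^n≡0⇒m≡0 p k

  p∤1 : ¬ p ∣ 1
  p∤1 p∣1 = ℕ.nonTrivial⇒≢1 {{prime⇒nonTrivial p-prime}} (ℕ.∣1⇒≡1 p∣1)

  p∤* : ∀ {m n} → ¬ p ∣ m → ¬ p ∣ n → ¬ p ∣ m ℕ.* n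
  p∤* {m} {n} p∤m p∤n p∣mn with euclidsLemma m n p-prime p∣mn
  ... | inj₁ p∣m = p∤m p∣m
  ... | inj₂ p∣n = p∤n p∣n

  p∤∣*∣ : ∀ m n → ¬ p ∣ ∣ m ∣ → ¬ p ∣ ∣ n ∣ → ¬ p ∣ ∣ m ℤ.* n ∣
  p∤∣*∣ m n p∤m p∤n = subst (λ k → ¬ p ∣ k) (sym (ℤ.abs-* m n)) (p∤* p∤m p∤n)

  p∤⇒coprime : ∀ {n} → ¬ p ∣ n → Coprime n p
  p∤⇒coprime p∤n (d∣n , d∣p) with prime⇒irreducible p-prime d∣p
  ... | inj₁ d≡1  = d≡1
  ... | inj₂ refl = contradiction d∣n p∤n

  coprime⇒p∤ : ∀ {n} → Coprime n p → ¬ p ∣ n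
  coprime⇒p∤ c p∣n = p∤1 (subst (p ∣_) (c (p∣n , ℕ.∣-refl)) ℕ.∣-refl)

  -- A common divisor of `p ^ suc k` and `n` is itself coprime to `p`, hence already divides
  -- `p ^ k`.
  p^k-coprime : ∀ k {n} → ¬ p ∣ n → Coprime (p ^ k) n
  p^k-coprime zero p∤n = Coprime.1-coprimeTo _
  p^k-coprime (suc k) p∤n {e} (e∣ , e∣n) =
    p^k-coprime k p∤n (coprime-divisor (λ (x , y) → p∤⇒coprime p∤n (ℕ.∣-trans x e∣n , y)) e∣ , e∣n)

  p-decompose : ∀ n → n ≢ 0 → Σ ℕ λ e → Σ ℕ λ n′ → (n ≡ p ^ e ℕ.* n′) × ¬ p ∣ n′
  p-decompose = <-rec _ step
    where
    step : ∀ n → (∀ {m} → m < n → m ≢ 0 → Σ ℕ λ e → Σ ℕ λ m′ → (m ≡ p ^ e ℕ.* m′) × ¬ p ∣ m′) →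
           n ≢ 0 → Σ ℕ λ e → Σ ℕ λ n′ → (n ≡ p ^ e ℕ.* n′) × ¬ p ∣ n′
    step n rec n≢0 with p ∣? n
    ... | no p∤n = 0 , n , sym (ℕ.*-identityˡ n) , p∤n
    ... | yes (divides m refl) =
      let instance _ = ℕ.≢-nonZero m≢0
                   _ = prime⇒nonTrivial p-prime
          e , m′ , eq , p∤m′ = rec (ℕ.m<m*n m p (ℕ.nonTrivial⇒n>1 p)) m≢0
      in suc e , m′ , trans (ℕ.*-comm m p) (trans (cong (p ℕ.*_) eq) (sym (ℕ.*-assoc p (p ^ e) m′))) , p∤m′
      where
      m≢0 : m ≢ 0
      m≢0 refl = n≢0 refl

  -- If only one exponent is positive, `p` divides the cofactor on the other side; if both are, one
  -- factor `p` cancels.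
  exponents-equal : ∀ m n {e e′} → ¬ p ∣ e → ¬ p ∣ e′ → e ℕ.* p ^ m ≡ e′ ℕ.* p ^ n → m ≡ n
  exponents-equal zero zero _ _ _ = refl
  exponents-equal zero (suc n) {e} {e′} p∤e _ eq = contradiction
    (subst (p ∣_) (trans (sym eq) (ℕ.*-identityʳ e)) (ℕ.∣n⇒∣m*n e′ (ℕ.m∣m*n (p ^ n)))) p∤e
  exponents-equal (suc m) zero {e} {e′} _ p∤e′ eq = contradiction
    (subst (p ∣_) (trans eq (ℕ.*-identityʳ e′)) (ℕ.∣n⇒∣m*n e (ℕ.m∣m*n (p ^ m)))) p∤e′
  exponents-equal (suc m) (suc n) {e} {e′} p∤e p∤e′ eq = cong suc (exponents-equal m n p∤e p∤e′
    (ℕ.*-cancelˡ-≡ _ _ p {{prime⇒nonZero p-prime}} (trans (swap p e (p ^ m)) (trans eq (sym (swap p e′ (p ^ n)))))))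
    where
    swap : ∀ a b c → a ℕ.* (b ℕ.* c) ≡ b ℕ.* (a ℕ.* c)
    swap = ℕ-solve 3 (λ a b c → a :*ℕ (b :*ℕ c) :=ℕ b :*ℕ (a :*ℕ c)) refl

  infix 4 p^_∣ℚ_
  -- Membership in pᵏ ℤ₍ₚ₎. The witnessing fraction need not be in lowest terms, so sums and
  -- products are handled by plain fraction arithmetic; the same holds for `Unit`.
  record p^_∣ℚ_ (k : ℕ) (q : ℚ) : Set where
    constructor frac
    field
      num den : ℤ
      p∤den   : ¬ p ∣ ∣ den ∣
      eq      : q * ℤ→ℚ den ≡ ℕ→ℚ (p ^ k) * ℤ→ℚ num

  record Unit (q : ℚ) : Set where
    constructor frac
    field
      num den : ℤ
      p∤num   : ¬ p ∣ ∣ num ∣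
      p∤den   : ¬ p ∣ ∣ den ∣
      eq      : q * ℤ→ℚ den ≡ ℤ→ℚ num

  ∣ℚ-ℤ : ∀ m → p^ 0 ∣ℚ ℤ→ℚ m
  ∣ℚ-ℤ m = frac m (+ 1) p∤1 (*-comm (ℤ→ℚ m) 1ℚ)

  ∣ℚ-pow : ∀ k → p^ k ∣ℚ ℕ→ℚ (p ^ k)
  ∣ℚ-pow k = frac (+ 1) (+ 1) p∤1 refl

  ∣ℚ-+ : ∀ {k q r} → p^ k ∣ℚ q → p^ k ∣ℚ r → p^ k ∣ℚ q + r
  ∣ℚ-+ {k} {q} {r} (frac m n p∤n e) (frac m′ n′ p∤n′ e′) =
    frac (m ℤ.* n′ ℤ.+ m′ ℤ.* n) (n ℤ.* n′) (p∤∣*∣ n n′ p∤n p∤n′) (begin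
    (q + r) * ℤ→ℚ (n ℤ.* n′)
      ≡⟨ cong ((q + r) *_) (ℤ→ℚ-homo-* n n′) ⟩
    (q + r) * (ℤ→ℚ n * ℤ→ℚ n′)
      ≡⟨ solve 4 (λ q r n n′ → (q :+ r) :* (n :* n′) := (q :* n) :* n′ :+ (r :* n′) :* n) refl q r (ℤ→ℚ n) (ℤ→ℚ n′) ⟩
    (q * ℤ→ℚ n) * ℤ→ℚ n′ + (r * ℤ→ℚ n′) * ℤ→ℚ n
      ≡⟨ cong₂ (λ u v → u * ℤ→ℚ n′ + v * ℤ→ℚ n) e e′ ⟩
    (ℕ→ℚ (p ^ k) * ℤ→ℚ m) * ℤ→ℚ n′ + (ℕ→ℚ (p ^ k) * ℤ→ℚ m′) * ℤ→ℚ n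
      ≡⟨ solve 5 (λ P m n′ m′ n → (P :* m) :* n′ :+ (P :* m′) :* n := P :* (m :* n′ :+ m′ :* n)) refl (ℕ→ℚ (p ^ k)) (ℤ→ℚ m) (ℤ→ℚ n′) (ℤ→ℚ m′) (ℤ→ℚ n) ⟩
    ℕ→ℚ (p ^ k) * (ℤ→ℚ m * ℤ→ℚ n′ + ℤ→ℚ m′ * ℤ→ℚ n)
      ≡⟨ cong (ℕ→ℚ (p ^ k) *_) (trans (ℤ→ℚ-homo-+ (m ℤ.* n′) (m′ ℤ.* n)) (cong₂ _+_ (ℤ→ℚ-homo-* m n′) (ℤ→ℚ-homo-* m′ n))) ⟨
    ℕ→ℚ (p ^ k) * ℤ→ℚ (m ℤ.* n′ ℤ.+ m′ ℤ.* n) ∎)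
    where open ≡-Reasoning

  ∣ℚ-* : ∀ {j k q r} → p^ j ∣ℚ q → p^ k ∣ℚ r → p^ (j ℕ.+ k) ∣ℚ q * r
  ∣ℚ-* {j} {k} {q} {r} (frac m n p∤n e) (frac m′ n′ p∤n′ e′) =
    frac (m ℤ.* m′) (n ℤ.* n′) (p∤∣*∣ n n′ p∤n p∤n′) (begin
    (q * r) * ℤ→ℚ (n ℤ.* n′)
      ≡⟨ cong ((q * r) *_) (ℤ→ℚ-homo-* n n′) ⟩
    (q * r) * (ℤ→ℚ n * ℤ→ℚ n′)
      ≡⟨ interchange q r (ℤ→ℚ n) (ℤ→ℚ n′) ⟩
    (q * ℤ→ℚ n) * (r * ℤ→ℚ n′)
      ≡⟨ cong₂ _*_ e e′ ⟩
    (ℕ→ℚ (p ^ j) * ℤ→ℚ m) * (ℕ→ℚ (p ^ k) * ℤ→ℚ m′)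
      ≡⟨ interchange (ℕ→ℚ (p ^ j)) (ℤ→ℚ m) (ℕ→ℚ (p ^ k)) (ℤ→ℚ m′) ⟩
    (ℕ→ℚ (p ^ j) * ℕ→ℚ (p ^ k)) * (ℤ→ℚ m * ℤ→ℚ m′)
      ≡⟨ cong₂ _*_ (trans (cong ℕ→ℚ (ℕ.^-distribˡ-+-* p j k)) (ℕ→ℚ-homo-* (p ^ j) (p ^ k))) (ℤ→ℚ-homo-* m m′) ⟨
    ℕ→ℚ (p ^ (j ℕ.+ k)) * ℤ→ℚ (m ℤ.* m′) ∎)
    where
    open ≡-Reasoning
    interchange : ∀ a b c d → (a * b) * (c * d) ≡ (a * c) * (b * d)
    interchange = solve 4 (λ a b c d → (a :* b) :* (c :* d) := (a :* c) :* (b :* d)) refl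

  ∣ℚ-neg : ∀ {k q} → p^ k ∣ℚ q → p^ k ∣ℚ - q
  ∣ℚ-neg {k} {q} h = subst (p^ k ∣ℚ_) (solve 1 (λ q → :- con 1ℚ :* q := :- q) refl q) (∣ℚ-* (∣ℚ-ℤ (ℤ.- (+ 1))) h)

  ∣ℚ-- : ∀ {k q r} → p^ k ∣ℚ q → p^ k ∣ℚ r → p^ k ∣ℚ q - r
  ∣ℚ-- hq hr = ∣ℚ-+ hq (∣ℚ-neg hr)

  ∣ℚ-cancel-pow : ∀ j {k q} → p^ (j ℕ.+ k) ∣ℚ ℕ→ℚ (p ^ j) * q → p^ k ∣ℚ q
  ∣ℚ-cancel-pow j {k} {q} (frac m n p∤n e) = frac m n p∤n (*-cancelˡ-≢0 (ℕ→ℚ≢0 (p ^ j) (p^k≢0 j)) (begin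
    ℕ→ℚ (p ^ j) * (q * ℤ→ℚ n)             ≡⟨ *-assoc (ℕ→ℚ (p ^ j)) q (ℤ→ℚ n) ⟨
    ℕ→ℚ (p ^ j) * q * ℤ→ℚ n               ≡⟨ e ⟩
    ℕ→ℚ (p ^ (j ℕ.+ k)) * ℤ→ℚ m           ≡⟨ cong (_* ℤ→ℚ m) (trans (cong ℕ→ℚ (ℕ.^-distribˡ-+-* p j k)) (ℕ→ℚ-homo-* (p ^ j) (p ^ k))) ⟩
    ℕ→ℚ (p ^ j) * ℕ→ℚ (p ^ k) * ℤ→ℚ m     ≡⟨ *-assoc (ℕ→ℚ (p ^ j)) (ℕ→ℚ (p ^ k)) (ℤ→ℚ m) ⟩
    ℕ→ℚ (p ^ j) * (ℕ→ℚ (p ^ k) * ℤ→ℚ m)   ∎))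
    where open ≡-Reasoning

  -- Multiplying by the integer `p ^ (k ∸ j)` keeps the exponent `k`; cancelling that power then
  -- leaves `j`.
  ∣ℚ-mono : ∀ {j k q} → j ≤ k → p^ k ∣ℚ q → p^ j ∣ℚ q
  ∣ℚ-mono {j} {k} {q} j≤k h = ∣ℚ-cancel-pow (k ℕ.∸ j)
    (subst (λ e → p^ e ∣ℚ ℕ→ℚ (p ^ (k ℕ.∸ j)) * q) (sym (ℕ.m∸n+n≡m j≤k))
      (∣ℚ-* {0} (∣ℚ-ℤ (+ (p ^ (k ℕ.∸ j)))) h))

  ∣ℚ-cancel-unit : ∀ {k q u} → Unit u → p^ k ∣ℚ q * u → p^ k ∣ℚ q
  ∣ℚ-cancel-unit {k} {q} {u} (frac m n p∤m p∤n e) (frac m′ n′ p∤n′ e′) =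
    frac (m′ ℤ.* n) (m ℤ.* n′) (p∤∣*∣ m n′ p∤m p∤n′) (begin
    q * ℤ→ℚ (m ℤ.* n′)                    ≡⟨ cong (q *_) (ℤ→ℚ-homo-* m n′) ⟩
    q * (ℤ→ℚ m * ℤ→ℚ n′)                  ≡⟨ cong (λ v → q * (v * ℤ→ℚ n′)) e ⟨
    q * (u * ℤ→ℚ n * ℤ→ℚ n′)              ≡⟨ solve 4 (λ q u n n′ → q :* (u :* n :* n′) := (q :* u :* n′) :* n) refl q u (ℤ→ℚ n) (ℤ→ℚ n′) ⟩
    (q * u * ℤ→ℚ n′) * ℤ→ℚ n              ≡⟨ cong (_* ℤ→ℚ n) e′ ⟩
    (ℕ→ℚ (p ^ k) * ℤ→ℚ m′) * ℤ→ℚ n        ≡⟨ *-assoc (ℕ→ℚ (p ^ k)) (ℤ→ℚ m′) (ℤ→ℚ n) ⟩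
    ℕ→ℚ (p ^ k) * (ℤ→ℚ m′ * ℤ→ℚ n)        ≡⟨ cong (ℕ→ℚ (p ^ k) *_) (ℤ→ℚ-homo-* m′ n) ⟨
    ℕ→ℚ (p ^ k) * ℤ→ℚ (m′ ℤ.* n)          ∎)
    where open ≡-Reasoning

  unit-ℤ : ∀ m → ¬ p ∣ ∣ m ∣ → Unit (ℤ→ℚ m)
  unit-ℤ m p∤m = frac m (+ 1) p∤m p∤1 (*-identityʳ (ℤ→ℚ m))

  unit-↥↧ : ∀ q → ¬ p ∣ ∣ ↥ q ∣ → ¬ p ∣ ↧ₙ q → Unit q
  unit-↥↧ q p∤↥ p∤↧ = frac (↥ q) (↧ q) p∤↥ p∤↧ (q*↧q≡↥q q)

  unit⇒∣ℚ : ∀ {q} → Unit q → p^ 0 ∣ℚ q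
  unit⇒∣ℚ (frac m n _ p∤n e) = frac m n p∤n (trans e (sym (*-identityˡ (ℤ→ℚ m))))

  unit-cancel : ∀ {q u} → Unit u → Unit (q * u) → Unit q
  unit-cancel {q} {u} (frac m n p∤m p∤n e) (frac m′ n′ p∤m′ p∤n′ e′) =
    frac (m′ ℤ.* n) (m ℤ.* n′) (p∤∣*∣ m′ n p∤m′ p∤n) (p∤∣*∣ m n′ p∤m p∤n′) (begin
    q * ℤ→ℚ (m ℤ.* n′)                    ≡⟨ cong (q *_) (ℤ→ℚ-homo-* m n′) ⟩
    q * (ℤ→ℚ m * ℤ→ℚ n′)                  ≡⟨ cong (λ v → q * (v * ℤ→ℚ n′)) e ⟨
    q * (u * ℤ→ℚ n * ℤ→ℚ n′)              ≡⟨ solve 4 (λ q u n n′ → q :* (u :* n :* n′) := (q :* u :* n′) :* n) refl q u (ℤ→ℚ n) (ℤ→ℚ n′) ⟩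
    (q * u * ℤ→ℚ n′) * ℤ→ℚ n              ≡⟨ cong (_* ℤ→ℚ n) e′ ⟩
    ℤ→ℚ m′ * ℤ→ℚ n                        ≡⟨ ℤ→ℚ-homo-* m′ n ⟨
    ℤ→ℚ (m′ ℤ.* n)                        ∎)
    where open ≡-Reasoning

  -- The numerator of the sum is congruent to `m n′` modulo `p`, and neither factor is divisible by
  -- `p`.
  unit-+ : ∀ {u q} → Unit u → p^ 1 ∣ℚ q → Unit (u + q)
  unit-+ {u} {q} (frac m n p∤m p∤n e) (frac m′ n′ p∤n′ e′) =
    frac (m ℤ.* n′ ℤ.+ P ℤ.* (m′ ℤ.* n)) (n ℤ.* n′) p∤sum (p∤∣*∣ n n′ p∤n p∤n′) (begin
    (u + q) * ℤ→ℚ (n ℤ.* n′)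
      ≡⟨ cong ((u + q) *_) (ℤ→ℚ-homo-* n n′) ⟩
    (u + q) * (ℤ→ℚ n * ℤ→ℚ n′)
      ≡⟨ solve 4 (λ q r n n′ → (q :+ r) :* (n :* n′) := (q :* n) :* n′ :+ (r :* n′) :* n) refl u q (ℤ→ℚ n) (ℤ→ℚ n′) ⟩
    (u * ℤ→ℚ n) * ℤ→ℚ n′ + (q * ℤ→ℚ n′) * ℤ→ℚ n
      ≡⟨ cong₂ (λ v w → v * ℤ→ℚ n′ + w * ℤ→ℚ n) e e′ ⟩
    ℤ→ℚ m * ℤ→ℚ n′ + (ℤ→ℚ P * ℤ→ℚ m′) * ℤ→ℚ n
      ≡⟨ cong (λ v → ℤ→ℚ m * ℤ→ℚ n′ + v) (*-assoc (ℤ→ℚ P) (ℤ→ℚ m′) (ℤ→ℚ n)) ⟩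
    ℤ→ℚ m * ℤ→ℚ n′ + ℤ→ℚ P * (ℤ→ℚ m′ * ℤ→ℚ n)
      ≡⟨ cong₂ _+_ (ℤ→ℚ-homo-* m n′) (trans (ℤ→ℚ-homo-* P (m′ ℤ.* n)) (cong (ℤ→ℚ P *_) (ℤ→ℚ-homo-* m′ n))) ⟨
    ℤ→ℚ (m ℤ.* n′) + ℤ→ℚ (P ℤ.* (m′ ℤ.* n))
      ≡⟨ ℤ→ℚ-homo-+ (m ℤ.* n′) (P ℤ.* (m′ ℤ.* n)) ⟨
    ℤ→ℚ (m ℤ.* n′ ℤ.+ P ℤ.* (m′ ℤ.* n)) ∎)
    where
    open ≡-Reasoning
    P : ℤ
    P = + (p ^ 1)
    p∣P : + p ℤ.∣ P
    p∣P = ℤ.∣-reflexive (cong +_ (sym (ℕ.*-identityʳ p)))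
    p∤sum : ¬ p ∣ ∣ m ℤ.* n′ ℤ.+ P ℤ.* (m′ ℤ.* n) ∣
    p∤sum h = p∤∣*∣ m n′ p∤m p∤n′
      (ℤ.∣⇒∣ᵤ (ℤ.∣m+n∣n⇒∣m {m = m ℤ.* n′} (ℤ.∣ᵤ⇒∣ h) (ℤ.∣m⇒∣m*n (m′ ℤ.* n) p∣P)))

  -- Clearing the three denominators gives an integer identity whose right side is prime to `p`; a
  -- factor `p` in the numerator of `q` would divide its left side.
  unit-factorˡ : ∀ {q r} → p^ 0 ∣ℚ q → p^ 0 ∣ℚ r → Unit (q * r) → Unit q
  unit-factorˡ {q} {r} (frac m n p∤n e) (frac m′ n′ p∤n′ e′) (frac m″ n″ p∤m″ p∤n″ e″) =
    frac m n p∤m p∤n (trans e (*-identityˡ (ℤ→ℚ m)))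
    where
    open ≡-Reasoning
    product : m ℤ.* (m′ ℤ.* n″) ≡ m″ ℤ.* (n ℤ.* n′)
    product = ℤ→ℚ-injective (begin
      ℤ→ℚ (m ℤ.* (m′ ℤ.* n″))
        ≡⟨ trans (ℤ→ℚ-homo-* m (m′ ℤ.* n″)) (cong (ℤ→ℚ m *_) (ℤ→ℚ-homo-* m′ n″)) ⟩
      ℤ→ℚ m * (ℤ→ℚ m′ * ℤ→ℚ n″)
        ≡⟨ cong₂ (λ v w → v * (w * ℤ→ℚ n″)) (trans e (*-identityˡ (ℤ→ℚ m))) (trans e′ (*-identityˡ (ℤ→ℚ m′))) ⟨
      (q * ℤ→ℚ n) * (r * ℤ→ℚ n′ * ℤ→ℚ n″)
        ≡⟨ solve 5 (λ q r n n′ n″ → (q :* n) :* (r :* n′ :* n″) := (q :* r :* n″) :* (n :* n′)) refl q r (ℤ→ℚ n) (ℤ→ℚ n′) (ℤ→ℚ n″) ⟩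
      (q * r * ℤ→ℚ n″) * (ℤ→ℚ n * ℤ→ℚ n′)
        ≡⟨ cong (_* (ℤ→ℚ n * ℤ→ℚ n′)) e″ ⟩
      ℤ→ℚ m″ * (ℤ→ℚ n * ℤ→ℚ n′)
        ≡⟨ trans (ℤ→ℚ-homo-* m″ (n ℤ.* n′)) (cong (ℤ→ℚ m″ *_) (ℤ→ℚ-homo-* n n′)) ⟨
      ℤ→ℚ (m″ ℤ.* (n ℤ.* n′)) ∎)
    p∤m : ¬ p ∣ ∣ m ∣
    p∤m h = p∤∣*∣ m″ (n ℤ.* n′) p∤m″ (p∤∣*∣ n n′ p∤n p∤n′)
      (subst (p ∣_) (cong ∣_∣ product) (subst (p ∣_) (sym (ℤ.abs-* m (m′ ℤ.* n″))) (ℕ.∣m⇒∣m*n _ h)))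

  p∣↥⇒p∤↧ : ∀ q → p ∣ ∣ ↥ q ∣ → ¬ p ∣ ↧ₙ q
  p∣↥⇒p∤↧ q p∣↥ p∣↧ = p∤1 (subst (p ∣_) (↥↧-coprime q (p∣↥ , p∣↧)) ℕ.∣-refl)

  -- Passes from an arbitrary fraction to lowest terms by cross-multiplication: the reduced
  -- numerator and denominator are not both divisible by `p`, so a factor `p` in one of them has
  -- nothing to balance it.
  unit⇒p∤ : ∀ {q} → Unit q → (¬ p ∣ ∣ ↥ q ∣) × (¬ p ∣ ↧ₙ q)
  unit⇒p∤ {q} (frac m n p∤m p∤n e) = p∤↥ , p∤↧
    where
    open ≡-Reasoning
    crossℤ : ↥ q ℤ.* n ≡ m ℤ.* ↧ q
    crossℤ = ℤ→ℚ-injective (begin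
      ℤ→ℚ (↥ q ℤ.* n)          ≡⟨ ℤ→ℚ-homo-* (↥ q) n ⟩
      ℤ→ℚ (↥ q) * ℤ→ℚ n        ≡⟨ cong (_* ℤ→ℚ n) (q*↧q≡↥q q) ⟨
      q * ℤ→ℚ (↧ q) * ℤ→ℚ n    ≡⟨ solve 3 (λ q d n → q :* d :* n := q :* n :* d) refl q (ℤ→ℚ (↧ q)) (ℤ→ℚ n) ⟩
      q * ℤ→ℚ n * ℤ→ℚ (↧ q)    ≡⟨ cong (_* ℤ→ℚ (↧ q)) e ⟩
      ℤ→ℚ m * ℤ→ℚ (↧ q)        ≡⟨ ℤ→ℚ-homo-* m (↧ q) ⟨
      ℤ→ℚ (m ℤ.* ↧ q)          ∎)
    cross : ∣ ↥ q ∣ ℕ.* ∣ n ∣ ≡ ∣ m ∣ ℕ.* ↧ₙ q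
    cross = trans (sym (ℤ.abs-* (↥ q) n)) (trans (cong ∣_∣ crossℤ) (ℤ.abs-* m (↧ q)))
    p∤↧ : ¬ p ∣ ↧ₙ q
    p∤↧ h = p∤* (λ h′ → p∣↥⇒p∤↧ q h′ h) p∤n (subst (p ∣_) (sym cross) (ℕ.∣n⇒∣m*n ∣ m ∣ h))
    p∤↥ : ¬ p ∣ ∣ ↥ q ∣
    p∤↥ h = p∤* p∤m (p∣↥⇒p∤↧ q h) (subst (p ∣_) cross (ℕ.∣m⇒∣m*n ∣ n ∣ h))

  -- Otherwise `q + (- q) = 0` would be a unit.
  unit⇒p∤ℚ : ∀ {q} → Unit q → ¬ p^ 1 ∣ℚ q
  unit⇒p∤ℚ {q} u h = proj₁ (unit⇒p∤ (subst Unit (+-inverseʳ q) (unit-+ u (∣ℚ-neg h)))) (p ℕ.∣0)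

  ∣ℚ-↥↧ : ∀ k q → ¬ p ∣ ↧ₙ q → p ^ k ∣ ∣ ↥ q ∣ → p^ k ∣ℚ q
  ∣ℚ-↥↧ k q p∤↧ h with ℤ.∣ᵤ⇒∣ {+ (p ^ k)} {↥ q} h
  ... | ℤ.divides m e = frac m (↧ q) p∤↧ (begin
    q * ℤ→ℚ (↧ q)               ≡⟨ q*↧q≡↥q q ⟩
    ℤ→ℚ (↥ q)                   ≡⟨ cong ℤ→ℚ e ⟩
    ℤ→ℚ (m ℤ.* + (p ^ k))       ≡⟨ ℤ→ℚ-homo-* m (+ (p ^ k)) ⟩
    ℤ→ℚ m * ℕ→ℚ (p ^ k)         ≡⟨ *-comm (ℤ→ℚ m) (ℕ→ℚ (p ^ k)) ⟩
    ℕ→ℚ (p ^ k) * ℤ→ℚ m         ∎)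
    where open ≡-Reasoning

  -- Denominators are absorbed by a sufficiently high power of p.
  ∣ℚ-eventually : ∀ j q → Σ ℕ λ k₀ → ∀ {k r} → k₀ ≤ k → p^ k ∣ℚ r → p^ j ∣ℚ q * r
  ∣ℚ-eventually j q with p-decompose (↧ₙ q) (λ ())
  ... | e , n , ↧q≡ , p∤n = e ℕ.+ j , λ {k} {r} k₀≤k h →
    ∣ℚ-cancel-unit (unit-ℤ (+ n) p∤n) (∣ℚ-cancel-pow e
      (subst (p^ (e ℕ.+ j) ∣ℚ_) (↥q*r r) (∣ℚ-* (∣ℚ-ℤ (↥ q)) (∣ℚ-mono k₀≤k h))))
    where
    open ≡-Reasoning
    ↥q*r : ∀ r → ℤ→ℚ (↥ q) * r ≡ ℕ→ℚ (p ^ e) * (q * r * ℕ→ℚ n)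
    ↥q*r r = begin
      ℤ→ℚ (↥ q) * r                     ≡⟨ cong (_* r) (q*↧q≡↥q q) ⟨
      q * ℕ→ℚ (↧ₙ q) * r                ≡⟨ cong (λ d → q * d * r) (trans (cong ℕ→ℚ ↧q≡) (ℕ→ℚ-homo-* (p ^ e) n)) ⟩
      q * (ℕ→ℚ (p ^ e) * ℕ→ℚ n) * r     ≡⟨ solve 4 (λ q P n r → q :* (P :* n) :* r := P :* (q :* r :* n)) refl q (ℕ→ℚ (p ^ e)) (ℕ→ℚ n) r ⟩
      ℕ→ℚ (p ^ e) * (q * r * ℕ→ℚ n)     ∎

n∣m<n⇒m≡0 : ∀ {m n} → n ∣ m → m < n → m ≡ 0
n∣m<n⇒m≡0 {zero}  _   _   = refl
n∣m<n⇒m≡0 {suc _} n∣m m<n = contradiction (ℕ.∣⇒≤ n∣m) (ℕ.<⇒≱ m<n)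

-- Signs and absolute values.

IsSign : ℚ → Set
IsSign q = q ≡ 1ℚ ⊎ q ≡ - 1ℚ

sign-* : ∀ {q r} → IsSign q → IsSign r → IsSign (q * r)
sign-* (inj₁ refl) (inj₁ refl) = inj₁ refl
sign-* (inj₁ refl) (inj₂ refl) = inj₂ refl
sign-* (inj₂ refl) (inj₁ refl) = inj₂ refl
sign-* (inj₂ refl) (inj₂ refl) = inj₁ refl

sign-neg : ∀ {q} → IsSign q → IsSign (- q)
sign-neg (inj₁ refl) = inj₂ refl
sign-neg (inj₂ refl) = inj₁ refl

sign≢0 : ∀ {q} → IsSign q → q ≢ 0ℚ
sign≢0 (inj₁ refl) ()
sign≢0 (inj₂ refl) ()

sign-∣∣ : ∀ m → Σ ℚ λ σ → IsSign σ × (ℤ→ℚ m ≡ σ * ℕ→ℚ ∣ m ∣)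
sign-∣∣ (+ n)      = 1ℚ , inj₁ refl , sym (*-identityˡ (ℕ→ℚ n))
sign-∣∣ ℤ.-[1+ n ] = - 1ℚ , inj₂ refl , solve 1 (λ q → :- q := :- con 1ℚ :* q) refl (ℕ→ℚ (suc n))

sign-cancel : ∀ {σ m n} → IsSign σ → σ * ℕ→ℚ m ≡ ℕ→ℚ n → m ≡ n
sign-cancel {m = m} {n} (inj₁ refl) eq =
  cong ∣_∣ (ℤ→ℚ-injective {+ m} {+ n} (trans (sym (*-identityˡ (ℕ→ℚ m))) eq))
sign-cancel {m = m} {n} (inj₂ refl) eq =
  trans (sym (ℤ.∣-i∣≡∣i∣ (+ m))) (cong ∣_∣ (ℤ→ℚ-injective {ℤ.- (+ m)} {+ n} (begin
    ℤ→ℚ (ℤ.- (+ m))             ≡⟨ cong ℤ→ℚ (ℤ.-1*i≡-i (+ m)) ⟨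
    ℤ→ℚ (ℤ.- (+ 1) ℤ.* + m)     ≡⟨ ℤ→ℚ-homo-* (ℤ.- (+ 1)) (+ m) ⟩
    - 1ℚ * ℕ→ℚ m                ≡⟨ eq ⟩
    ℕ→ℚ n                       ∎)))
  where open ≡-Reasoning

sign-*-self : ∀ {σ} → IsSign σ → σ * σ ≡ 1ℚ
sign-*-self (inj₁ refl) = refl
sign-*-self (inj₂ refl) = refl

-- Lets an identity between naturals be derived from one in ℚ that is known only up to sign.
signs-cancel : ∀ {σ τ m n} → IsSign σ → IsSign τ → σ * ℕ→ℚ m ≡ τ * ℕ→ℚ n → m ≡ n
signs-cancel {σ} {τ} {m} {n} hσ hτ eq = sign-cancel (sign-* hτ hσ) (begin
  τ * σ * ℕ→ℚ m      ≡⟨ *-assoc τ σ (ℕ→ℚ m) ⟩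
  τ * (σ * ℕ→ℚ m)    ≡⟨ cong (τ *_) eq ⟩
  τ * (τ * ℕ→ℚ n)    ≡⟨ *-assoc τ τ (ℕ→ℚ n) ⟨
  τ * τ * ℕ→ℚ n      ≡⟨ cong (_* ℕ→ℚ n) (sign-*-self hτ) ⟩
  1ℚ * ℕ→ℚ n         ≡⟨ *-identityˡ (ℕ→ℚ n) ⟩
  ℕ→ℚ n              ∎)
  where open ≡-Reasoning

-- Truncations of z and p-adic integrality in K.

module Algorithm
  (p : ℕ) (p-prime : Prime p) (b c : ℚ) (d : ℕ → ℕ) (ε : ℚ)
  (p∤↧b : Setup.PIntegral p b c d ε b) (p∤↧c : Setup.PIntegral p b c d ε c)
  (p∤↥b : ¬ p ∣ ∣ ↥ b ∣) (d₀≡0 : d 0 ≡ 0) (root : Setup.IsRoot p b c d ε)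
  (ε-sign : IsSign ε)
  where

  open Setup p b c d ε
  open Valuation p p-prime

  sign-unit : ∀ {q} → IsSign q → Unit q
  sign-unit (inj₁ refl) = unit-ℤ (+ 1) p∤1
  sign-unit (inj₂ refl) = unit-ℤ (ℤ.- (+ 1)) p∤1

  eval : ℕ → K → ℚ
  eval k (a₀ , a₁) = a₀ + a₁ * Zq k

  -- α ∈ pʲ ℤ_p, where α ∈ K is approximated by the rationals obtained by truncating z.
  p^_∣K_ : ℕ → K → Set
  p^ j ∣K α = Σ ℕ λ k₀ → ∀ k → k₀ ≤ k → p^ j ∣ℚ eval k α

  -- This is z ∈ p ℤ_p: the only digit not weighted by a positive power of `p` is `d 0`, which
  -- vanishes.
  p∣Ztr : ∀ k → p ∣ Ztr k
  p∣Ztr zero = p ℕ.∣0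
  p∣Ztr (suc zero) rewrite d₀≡0 = p ℕ.∣0
  p∣Ztr (suc (suc k)) = ℕ.∣m∣n⇒∣m+n (p∣Ztr (suc k)) (ℕ.∣n⇒∣m*n (d (suc k)) (ℕ.m∣m*n (p ^ k)))

  p∣Zq : ∀ k → p^ 1 ∣ℚ Zq k
  p∣Zq k = subst (p^ 1 ∣ℚ_)
    (trans (cong (λ m → ℕ→ℚ n * ℕ→ℚ m) (ℕ.*-identityʳ p)) (trans (sym (ℕ→ℚ-homo-* n p)) (cong ℕ→ℚ (sym (_∣_.equality (p∣Ztr k))))))
    (∣ℚ-* (∣ℚ-ℤ (+ n)) (∣ℚ-pow 1))
    where n = _∣_.quotient (p∣Ztr k)

  Ztr-tail : ∀ e j → Σ ℕ λ n → Ztr (j ℕ.+ e) ≡ Ztr e ℕ.+ p ^ e ℕ.* n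
  Ztr-tail e zero = 0 , sym (trans (cong (Ztr e ℕ.+_) (ℕ.*-zeroʳ (p ^ e))) (ℕ.+-identityʳ (Ztr e)))
  Ztr-tail e (suc j) with Ztr-tail e j
  ... | n , eq = n ℕ.+ d (j ℕ.+ e) ℕ.* p ^ j , (begin
    Ztr (j ℕ.+ e) ℕ.+ D ℕ.* p ^ (j ℕ.+ e)                  ≡⟨ cong₂ (λ u v → u ℕ.+ D ℕ.* v) eq (ℕ.^-distribˡ-+-* p j e) ⟩
    Ztr e ℕ.+ p ^ e ℕ.* n ℕ.+ D ℕ.* (p ^ j ℕ.* p ^ e)      ≡⟨ ℕ.+-assoc (Ztr e) (p ^ e ℕ.* n) _ ⟩
    Ztr e ℕ.+ (p ^ e ℕ.* n ℕ.+ D ℕ.* (p ^ j ℕ.* p ^ e))    ≡⟨ cong (λ u → Ztr e ℕ.+ (p ^ e ℕ.* n ℕ.+ u)) (trans (sym (ℕ.*-assoc D (p ^ j) (p ^ e))) (ℕ.*-comm (D ℕ.* p ^ j) (p ^ e))) ⟩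
    Ztr e ℕ.+ (p ^ e ℕ.* n ℕ.+ p ^ e ℕ.* (D ℕ.* p ^ j))    ≡⟨ cong (Ztr e ℕ.+_) (ℕ.*-distribˡ-+ (p ^ e) n (D ℕ.* p ^ j)) ⟨
    Ztr e ℕ.+ p ^ e ℕ.* (n ℕ.+ D ℕ.* p ^ j)                ∎)
    where
    open ≡-Reasoning
    D : ℕ
    D = d (j ℕ.+ e)

  Zq-tail : ∀ e k → e ≤ k → Σ ℕ λ n → Zq k ≡ Zq e + ℕ→ℚ (p ^ e) * ℕ→ℚ n
  Zq-tail e k e≤k =
    let n , eq = Ztr-tail e (k ℕ.∸ e) in
    n , trans (cong Zq (sym (ℕ.m∸n+n≡m e≤k))) (trans (cong ℕ→ℚ eq)
      (trans (ℕ→ℚ-homo-+ (Ztr e) (p ^ e ℕ.* n)) (cong (λ u → Zq e + u) (ℕ→ℚ-homo-* (p ^ e) n))))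

  root-∣ℚ : ∀ k → p^ k ∣ℚ Zq k * Zq k + b * Zq k + c
  root-∣ℚ k = ∣ℚ-↥↧ k _ (proj₁ (root k)) (proj₂ (root k))

  -- Let `p ^ e` be the exact power of `p` in the product D of the denominators. `InZp` at `e` says
  -- that D α, computed with `e` digits of z, is divisible by `p ^ e`. Further digits change it by D
  -- a₁ times a multiple of `p ^ e`, and D a₁ is an integer. Dividing by D = `p ^ e * n` leaves a
  -- p-integral value.
  InZp⇒∣K : ∀ α → InZp α → p^ 0 ∣K α
  InZp⇒∣K (a₀ , a₁) int = e , λ k e≤k →
    ∣ℚ-cancel-unit (unit-ℤ (+ n) p∤n) (∣ℚ-cancel-pow e
      (subst (λ j → p^ j ∣ℚ P * (eval k (a₀ , a₁) * ℕ→ℚ n)) (sym (ℕ.+-identityʳ e)) (scaled k e≤k)))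
    where
    open ≡-Reasoning
    decomposition = p-decompose (↧ₙ a₀ ℕ.* ↧ₙ a₁) (λ ())
    e = proj₁ decomposition
    n = proj₁ (proj₂ decomposition)
    D≡ : ↧ₙ a₀ ℕ.* ↧ₙ a₁ ≡ p ^ e ℕ.* n
    D≡ = proj₁ (proj₂ (proj₂ decomposition))
    p∤n : ¬ p ∣ n
    p∤n = proj₂ (proj₂ (proj₂ decomposition))
    P = ℕ→ℚ (p ^ e)
    D = ℕ→ℚ (↧ₙ a₀ ℕ.* ↧ₙ a₁)
    D-int : p ^ e ∣ ↧ₙ a₀ ℕ.* ↧ₙ a₁
    D-int = divides n (trans D≡ (ℕ.*-comm (p ^ e) n))
    at-e : p^ e ∣ℚ D * a₀ + D * a₁ * Zq e
    at-e = ∣ℚ-↥↧ e _ (proj₁ (int e D-int)) (proj₂ (int e D-int))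
    Da₁ : ℤ→ℚ (↥ a₁) * ℕ→ℚ (↧ₙ a₀) ≡ D * a₁
    Da₁ = begin
      ℤ→ℚ (↥ a₁) * ℕ→ℚ (↧ₙ a₀)             ≡⟨ cong (_* ℕ→ℚ (↧ₙ a₀)) (q*↧q≡↥q a₁) ⟨
      a₁ * ℕ→ℚ (↧ₙ a₁) * ℕ→ℚ (↧ₙ a₀)       ≡⟨ solve 3 (λ x y z → x :* y :* z := z :* y :* x) refl a₁ (ℕ→ℚ (↧ₙ a₁)) (ℕ→ℚ (↧ₙ a₀)) ⟩
      ℕ→ℚ (↧ₙ a₀) * ℕ→ℚ (↧ₙ a₁) * a₁       ≡⟨ cong (_* a₁) (ℕ→ℚ-homo-* (↧ₙ a₀) (↧ₙ a₁)) ⟨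
      D * a₁                               ∎
    Da₁-int : p^ 0 ∣ℚ D * a₁
    Da₁-int = subst (p^ 0 ∣ℚ_) Da₁ (∣ℚ-* (∣ℚ-ℤ (↥ a₁)) (∣ℚ-ℤ (+ (↧ₙ a₀))))
    scaled : ∀ k → e ≤ k → p^ e ∣ℚ P * (eval k (a₀ , a₁) * ℕ→ℚ n)
    scaled k e≤k = let m , Zk≡ = Zq-tail e k e≤k in subst (p^ e ∣ℚ_) (begin
      D * a₀ + D * a₁ * Zq e + D * a₁ * (P * ℕ→ℚ m)
        ≡⟨ solve 5 (λ D a₀ a₁ z t → D :* a₀ :+ D :* a₁ :* z :+ D :* a₁ :* t := D :* (a₀ :+ a₁ :* (z :+ t))) refl D a₀ a₁ (Zq e) (P * ℕ→ℚ m) ⟩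
      D * (a₀ + a₁ * (Zq e + P * ℕ→ℚ m))
        ≡⟨ cong₂ (λ u v → u * (a₀ + a₁ * v)) (trans (cong ℕ→ℚ D≡) (ℕ→ℚ-homo-* (p ^ e) n)) (sym Zk≡) ⟩
      P * ℕ→ℚ n * (a₀ + a₁ * Zq k)
        ≡⟨ solve 3 (λ P n v → P :* n :* v := P :* (v :* n)) refl P (ℕ→ℚ n) (a₀ + a₁ * Zq k) ⟩
      P * ((a₀ + a₁ * Zq k) * ℕ→ℚ n) ∎)
      (∣ℚ-+ at-e (∣ℚ-* {0} {e} Da₁-int (subst (λ j → p^ j ∣ℚ P * ℕ→ℚ m) (ℕ.+-identityʳ e) (∣ℚ-* (∣ℚ-pow e) (∣ℚ-ℤ (+ m))))))

  eval-scaleK : ∀ q α k → eval k (scaleK q α) ≡ q * eval k α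
  eval-scaleK q (a₀ , a₁) k =
    solve 4 (λ q a₀ a₁ z → q :* a₀ :+ q :* a₁ :* z := q :* (a₀ :+ a₁ :* z)) refl q a₀ a₁ (Zq k)

  p∣pℚ : p^ 1 ∣ℚ pℚ
  p∣pℚ = subst (λ m → p^ 1 ∣ℚ ℕ→ℚ m) (ℕ.*-identityʳ p) (∣ℚ-pow 1)

  InpZp⇒∣K : ∀ α → InpZp α → p^ 1 ∣K α
  InpZp⇒∣K _ (γ , α≡pγ , γ-int) =
    let k₀ , h = InZp⇒∣K γ γ-int in
    k₀ , λ k k₀≤k → subst (p^ 1 ∣ℚ_) (sym (trans (cong (eval k) α≡pγ) (eval-scaleK pℚ γ k))) (∣ℚ-* p∣pℚ (h k k₀≤k))

  -- Here s = m / pʲ with m < pʲ⁺¹. If `p` divides s then pʲ⁺¹ divides m, which forces m = 0.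
  fractional-part-zero : ∀ {q s} → FracPart q s → p^ 1 ∣ℚ s → s ≡ 0ℚ
  fractional-part-zero {q} {s} (j , m , s*p^j≡m , m<p^1+j , _) (frac m′ n p∤n e) =
    q*r≡0⇒r≡0 (ℕ→ℚ≢0 (p ^ j) (p^k≢0 j)) (trans (*-comm (ℕ→ℚ (p ^ j)) s) (trans s*p^j≡m (cong ℕ→ℚ m≡0)))
    where
    open ≡-Reasoning
    product : n ℤ.* + m ≡ m′ ℤ.* + (p ^ suc j)
    product = ℤ→ℚ-injective (begin
      ℤ→ℚ (n ℤ.* + m)                              ≡⟨ ℤ→ℚ-homo-* n (+ m) ⟩
      ℤ→ℚ n * ℕ→ℚ m                                ≡⟨ cong (ℤ→ℚ n *_) s*p^j≡m ⟨
      ℤ→ℚ n * (s * ℕ→ℚ (p ^ j))                    ≡⟨ solve 3 (λ n s P → n :* (s :* P) := s :* n :* P) refl (ℤ→ℚ n) s (ℕ→ℚ (p ^ j)) ⟩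
      s * ℤ→ℚ n * ℕ→ℚ (p ^ j)                      ≡⟨ cong (_* ℕ→ℚ (p ^ j)) e ⟩
      ℕ→ℚ (p ^ 1) * ℤ→ℚ m′ * ℕ→ℚ (p ^ j)           ≡⟨ solve 3 (λ P m P′ → P :* m :* P′ := m :* (P :* P′)) refl (ℕ→ℚ (p ^ 1)) (ℤ→ℚ m′) (ℕ→ℚ (p ^ j)) ⟩
      ℤ→ℚ m′ * (ℕ→ℚ (p ^ 1) * ℕ→ℚ (p ^ j))         ≡⟨ cong (ℤ→ℚ m′ *_) (trans (cong ℕ→ℚ (ℕ.^-distribˡ-+-* p 1 j)) (ℕ→ℚ-homo-* (p ^ 1) (p ^ j))) ⟨
      ℤ→ℚ m′ * ℕ→ℚ (p ^ suc j)                     ≡⟨ ℤ→ℚ-homo-* m′ (+ (p ^ suc j)) ⟨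
      ℤ→ℚ (m′ ℤ.* + (p ^ suc j))                   ∎)
    p^1+j∣m : p ^ suc j ∣ m
    p^1+j∣m = coprime-divisor (p^k-coprime (suc j) p∤n) (divides ∣ m′ ∣
      (trans (sym (ℤ.abs-* n (+ m))) (trans (cong ∣_∣ product) (ℤ.abs-* m′ (+ (p ^ suc j))))))
    m≡0 : m ≡ 0
    m≡0 = n∣m<n⇒m≡0 p^1+j∣m m<p^1+j

  -- One step of the map.

  IsPower : ℚ → Set
  IsPower ρ = (Σ ℕ λ n → ρ ≡ ℕ→ℚ (p ^ n)) ⊎ (Σ ℕ λ n → ρ * ℕ→ℚ (p ^ suc n) ≡ 1ℚ)

  -- `EqPow` clears denominators when the exponent is negative. With ρ = pᵛ as an actual rational,
  -- both cases read α = ρ β.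
  power : ∀ v → Σ ℚ λ ρ → IsPower ρ × ρ ≢ 0ℚ × (∀ {α β} → EqPow v α β → α ≡ scaleK ρ β)
  power (+ n) = ℕ→ℚ (p ^ n) , inj₁ (n , refl) , ℕ→ℚ≢0 (p ^ n) (p^k≢0 n) , λ eq → eq
  power ℤ.-[1+ n ] = 1/ P , inj₂ (n , *-inverseˡ P) , ρ≢0 , unscale
    where
    P = ℕ→ℚ (p ^ suc n)
    P≢0 : P ≢ 0ℚ
    P≢0 = ℕ→ℚ≢0 (p ^ suc n) (p^k≢0 (suc n))
    instance _ = ≢-nonZero P≢0
    ρ≢0 : 1/ P ≢ 0ℚ
    ρ≢0 eq = sign≢0 (inj₁ refl) (trans (sym (*-inverseˡ P)) (trans (cong (_* P) eq) (*-zeroˡ P)))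
    undo : ∀ u → 1/ P * (P * u) ≡ u
    undo u = trans (sym (*-assoc (1/ P) P u)) (trans (cong (_* u) (*-inverseˡ P)) (*-identityˡ u))
    unscale : ∀ {α β} → scaleK P α ≡ β → α ≡ scaleK (1/ P) β
    unscale {a₀ , a₁} refl = cong₂ _,_ (sym (undo a₀)) (sym (undo a₁))

  largestCoprime⇒p∤ : ∀ {q a} → LargestCoprime q a → ¬ p ∣ a
  largestCoprime⇒p∤ (inj₁ (_ , refl)) = p∤1
  largestCoprime⇒p∤ (inj₂ (_ , _ , cop , _)) = coprime⇒p∤ cop

  -- The numerator is itself prime to `p`, so it is its own largest divisor prime to `p`.
  largestCoprime-unit : ∀ {q a} → Unit q → LargestCoprime q a → a ≡ ∣ ↥ q ∣
  largestCoprime-unit u (inj₁ (refl , _)) = contradiction (p ℕ.∣0) (proj₁ (unit⇒p∤ u))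
  largestCoprime-unit {q} u (inj₂ (q≢0 , _ , _ , a∣ , largest)) = ℕ.≤-antisym
    (ℕ.∣⇒≤ {{ℕ.≢-nonZero ↥≢0}} a∣)
    (largest ∣ ↥ q ∣ (ℕ.n≢0⇒n>0 ↥≢0) (p∤⇒coprime (proj₁ (unit⇒p∤ u))) ℕ.∣-refl)
    where
    ↥≢0 : ∣ ↥ q ∣ ≢ 0
    ↥≢0 eq = q≢0 (↥p≡0⇒p≡0 q (ℤ.∣i∣≡0⇒i≡0 eq))

  -- What later arguments need from `TSpec` when α ≠ 0: ρ = pᵛ with v the order of α, x = ε ρ / α,
  -- and y = α / ρ. The integral y with x y = ε certifies that x is a p-adic unit. The field `β₀≡0`
  -- records that the rational coordinate of β has no digits of positive index.
  record Step (α β : K) : Set where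
    field
      x y       : K
      ρ         : ℚ
      ρ-power   : IsPower ρ
      ρ≢0       : ρ ≢ 0ℚ
      x-int     : p^ 0 ∣K x
      y-int     : p^ 0 ∣K y
      x*α       : x *K α ≡ scaleK ρ (ι ε)
      x*y       : x *K y ≡ ι ε
      a′        : ℕ
      a′-largest : LargestCoprime (proj₂ x) a′
      β₁*a′     : proj₂ β * ℕ→ℚ a′ ≡ proj₂ x
      p∣β       : p^ 1 ∣K β
      β₀≡0      : p^ 1 ∣ℚ proj₁ β → proj₁ β ≡ 0ℚ

  *K-scaleK : ∀ q α β → α *K scaleK q β ≡ scaleK q (α *K β)
  *K-scaleK q (a₀ , a₁) (b₀ , b₁) = cong₂ _,_
    (solve 6 (λ q a₀ a₁ b₀ b₁ c → a₀ :* (q :* b₀) :- c :* (a₁ :* (q :* b₁)) := q :* (a₀ :* b₀ :- c :* (a₁ :* b₁))) refl q a₀ a₁ b₀ b₁ c)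
    (solve 6 (λ q a₀ a₁ b₀ b₁ b → a₀ :* (q :* b₁) :+ a₁ :* (q :* b₀) :- b :* (a₁ :* (q :* b₁)) := q :* (a₀ :* b₁ :+ a₁ :* b₀ :- b :* (a₁ :* b₁))) refl q a₀ a₁ b₀ b₁ b)

  scaleK-cancel : ∀ {q α β} → q ≢ 0ℚ → scaleK q α ≡ scaleK q β → α ≡ β
  scaleK-cancel q≢0 eq = cong₂ _,_ (*-cancelˡ-≢0 q≢0 (cong proj₁ eq)) (*-cancelˡ-≢0 q≢0 (cong proj₂ eq))

  step : ∀ {α β} → α ≢ 0K → TSpec α β → Step α β
  step α≢0 (inj₁ (α≡0 , _)) = contradiction α≡0 α≢0
  step {α} {β@(β₀ , β₁)} _ (inj₂ (_ , v , x@(x₀ , x₁) , w , a′ , q , s , (y , α≈y , y-int , _) , x*α≈ε , (_ , g∈pZp) , largest , q*a′≡g₀ , s-frac@(_ , _ , _ , _ , q-s) , β-eq)) = record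
    { x = x ; y = y ; ρ = ρ ; ρ-power = proj₁ (proj₂ (power v)) ; ρ≢0 = ρ≢0
    -- x is recovered as g + w, with g in p ℤ_p and w an integer.
    ; x-int = proj₁ p∣g , λ k k₀≤k → subst (p^ 0 ∣ℚ_) (g+w k)
        (∣ℚ-+ (∣ℚ-mono ℕ.z≤n (proj₂ p∣g k k₀≤k)) (∣ℚ-ℤ (+ w)))
    ; y-int = InZp⇒∣K y y-int
    ; x*α = ρ-eq x*α≈ε
    -- Substitute α = ρ y into x α = ρ ε and cancel ρ.
    ; x*y = scaleK-cancel ρ≢0 (trans (sym (*K-scaleK ρ x y)) (trans (cong (x *K_) (sym (ρ-eq α≈y))) (ρ-eq x*α≈ε)))
    ; a′ = a′
    ; a′-largest = subst (λ u → LargestCoprime u a′) (+-identityʳ x₁) largest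
    ; β₁*a′ = trans (*-comm β₁ (ℕ→ℚ a′)) (trans (cong (ℕ→ℚ a′ *_) (sym (+-identityʳ β₁))) (trans (cong proj₂ β-eq) (+-identityʳ x₁)))
    -- a′ β = g - a′ (q - s), where g and q - s are divisible by `p` and a′ is a unit.
    ; p∣β = proj₁ p∣g , λ k k₀≤k → ∣ℚ-cancel-unit a′-unit (subst (p^ 1 ∣ℚ_) (g-frac k)
        (∣ℚ-- (proj₂ p∣g k k₀≤k) (∣ℚ-* (∣ℚ-ℤ (+ a′)) (∣ℚ-↥↧ 1 _ (proj₁ q-s) (proj₂ q-s)))))
    ; β₀≡0 = λ h → trans β₀≡s (fractional-part-zero {q} {s} s-frac (subst (p^ 1 ∣ℚ_) β₀≡s h))
    }
    where
    open ≡-Reasoning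
    ρ = proj₁ (power v)
    ρ≢0 : ρ ≢ 0ℚ
    ρ≢0 = proj₁ (proj₂ (proj₂ (power v)))
    ρ-eq : ∀ {α β} → EqPow v α β → α ≡ scaleK ρ β
    ρ-eq = proj₂ (proj₂ (proj₂ (power v)))
    p∣g : p^ 1 ∣K (x -K ι (ℕ→ℚ w))
    p∣g = InpZp⇒∣K (x -K ι (ℕ→ℚ w)) g∈pZp
    a′-unit : Unit (ℕ→ℚ a′)
    a′-unit = unit-ℤ (+ a′) (largestCoprime⇒p∤ largest)
    g+w : ∀ k → eval k (x -K ι (ℕ→ℚ w)) + ℕ→ℚ w ≡ eval k x
    g+w k = solve 4 (λ x₀ x₁ w z → x₀ :- w :+ (x₁ :- con 0ℚ) :* z :+ w := x₀ :+ x₁ :* z) refl x₀ x₁ (ℕ→ℚ w) (Zq k)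
    g-frac : ∀ k → eval k (x -K ι (ℕ→ℚ w)) - ℕ→ℚ a′ * (q - s) ≡ eval k β * ℕ→ℚ a′
    g-frac k = begin
      x₀ - ℕ→ℚ w + (x₁ - 0ℚ) * Zq k - ℕ→ℚ a′ * (q - s)
        ≡⟨ cong₂ (λ u v → u + v * Zq k - ℕ→ℚ a′ * (q - s)) (sym (cong proj₁ β-eq)) (sym (cong proj₂ β-eq)) ⟩
      ℕ→ℚ a′ * (β₀ + (q - s)) + ℕ→ℚ a′ * (β₁ + 0ℚ) * Zq k - ℕ→ℚ a′ * (q - s)
        ≡⟨ solve 5 (λ a β₀ β₁ f z → a :* (β₀ :+ f) :+ a :* (β₁ :+ con 0ℚ) :* z :- a :* f := (β₀ :+ β₁ :* z) :* a) refl (ℕ→ℚ a′) β₀ β₁ (q - s) (Zq k) ⟩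
      (β₀ + β₁ * Zq k) * ℕ→ℚ a′ ∎
    a′≢0 : ℕ→ℚ a′ ≢ 0ℚ
    a′≢0 = ℕ→ℚ≢0 a′ λ where refl → largestCoprime⇒p∤ largest (p ℕ.∣0)
    -- Since q = g₀ / a′, the rational coordinate of β is q - (q - s).
    β₀≡s : β₀ ≡ s
    β₀≡s = begin
      β₀                     ≡⟨ solve 3 (λ β₀ q s → β₀ := β₀ :+ (q :- s) :- q :+ s) refl β₀ q s ⟩
      β₀ + (q - s) - q + s   ≡⟨ cong (λ u → u - q + s) (*-cancelˡ-≢0 a′≢0 (trans (cong proj₁ β-eq) (trans (sym q*a′≡g₀) (*-comm q (ℕ→ℚ a′))))) ⟩
      q - q + s              ≡⟨ solve 2 (λ q s → q :- q :+ s := s) refl q s ⟩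
      s                      ∎

  -- Both β and β₁ z lie in p ℤ_p, so β₀ does too; having no digits of positive index, it is 0.
  integral⇒β₀≡0 : ∀ {α β} → Step α β → p^ 0 ∣ℚ proj₂ β → proj₁ β ≡ 0ℚ
  integral⇒β₀≡0 {β = β₀ , β₁} S β₁-int = β₀≡0 (subst (p^ 1 ∣ℚ_)
    (solve 3 (λ β₀ β₁ z → β₀ :+ β₁ :* z :- β₁ :* z := β₀) refl β₀ β₁ (Zq (proj₁ p∣β)))
    (∣ℚ-- (proj₂ p∣β (proj₁ p∣β) ℕ.≤-refl) (∣ℚ-* β₁-int (p∣Zq (proj₁ p∣β)))))
    where open Step S

  -- Rational and irrational elements under a step.

  a′≢0 : ∀ {α β} (S : Step α β) → ℕ→ℚ (Step.a′ S) ≢ 0ℚ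
  a′≢0 S = ℕ→ℚ≢0 _ λ eq → largestCoprime⇒p∤ (Step.a′-largest S) (subst (p ∣_) (sym eq) (p ℕ.∣0))

  -- The inverse of a rational is rational: the z-coordinate of x a = ρ ε gives x₁ = 0, hence β₁ =
  -- 0, and then β₀ = 0 by integrality.
  rational-step : ∀ {a β} → Step (ι a) β → a ≢ 0ℚ → β ≡ 0K
  rational-step {a} {β₀ , β₁} S a≢0 = cong₂ _,_ (integral⇒β₀≡0 S (subst (p^ 0 ∣ℚ_) (sym β₁≡0) (∣ℚ-ℤ (+ 0)))) β₁≡0
    where
    open Step S
    open ≡-Reasoning
    x₀ = proj₁ x
    x₁ = proj₂ x
    x₁≡0 : x₁ ≡ 0ℚ
    x₁≡0 = q*r≡0⇒r≡0 a≢0 (begin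
      a * x₁                                     ≡⟨ solve 4 (λ a x₀ x₁ b → a :* x₁ := x₀ :* con 0ℚ :+ x₁ :* a :- b :* (x₁ :* con 0ℚ)) refl a x₀ x₁ b ⟩
      x₀ * 0ℚ + x₁ * a - b * (x₁ * 0ℚ)           ≡⟨ cong proj₂ x*α ⟩
      ρ * 0ℚ                                     ≡⟨ *-zeroʳ ρ ⟩
      0ℚ                                         ∎)
    β₁≡0 : β₁ ≡ 0ℚ
    β₁≡0 = q*r≡0⇒r≡0 (a′≢0 S) (trans (*-comm (ℕ→ℚ a′) β₁) (trans β₁*a′ x₁≡0))

  -- If β₁ = 0 then x₁ = 0, and the z-coordinate of x α = ρ ε leaves x₀ α₁ = 0. So x = 0,
  -- contradicting ρ ε ≠ 0.
  irrational-step : ∀ {α β} → Step α β → proj₂ α ≢ 0ℚ → proj₂ β ≢ 0ℚ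
  irrational-step {α₀ , α₁} {β₀ , β₁} S α₁≢0 β₁≡0 = *-≢0 ρ≢0 (sign≢0 ε-sign) (begin
    ρ * ε                                        ≡⟨ cong proj₁ x*α ⟨
    x₀ * α₀ - c * (x₁ * α₁)                      ≡⟨ cong₂ (λ u v → u * α₀ - c * (v * α₁)) x₀≡0 x₁≡0 ⟩
    0ℚ * α₀ - c * (0ℚ * α₁)                      ≡⟨ solve 3 (λ a c a′ → con 0ℚ :* a :- c :* (con 0ℚ :* a′) := con 0ℚ) refl α₀ c α₁ ⟩
    0ℚ                                           ∎)
    where
    open Step S
    open ≡-Reasoning
    x₀ = proj₁ x
    x₁ = proj₂ x
    x₁≡0 : x₁ ≡ 0ℚ
    x₁≡0 = trans (sym β₁*a′) (trans (cong (_* ℕ→ℚ a′) β₁≡0) (*-zeroˡ (ℕ→ℚ a′)))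
    x₀≡0 : x₀ ≡ 0ℚ
    x₀≡0 = q*r≡0⇒r≡0 α₁≢0 (begin
      α₁ * x₀                                    ≡⟨ solve 4 (λ a₀ a₁ x₀ b → a₁ :* x₀ := x₀ :* a₁ :+ con 0ℚ :* a₀ :- b :* (con 0ℚ :* a₁)) refl α₀ α₁ x₀ b ⟩
      x₀ * α₁ + 0ℚ * α₀ - b * (0ℚ * α₁)          ≡⟨ cong (λ u → x₀ * α₁ + u * α₀ - b * (u * α₁)) x₁≡0 ⟨
      x₀ * α₁ + x₁ * α₀ - b * (x₁ * α₁)          ≡⟨ cong proj₂ x*α ⟩
      ρ * 0ℚ                                     ≡⟨ *-zeroʳ ρ ⟩
      0ℚ                                         ∎)

  -- Unit coefficients along an irrational orbit.

  -- α / α₁ = u + z lies in p ℤ_p.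
  record Reduced (α : K) : Set where
    field
      α₁≢0  : proj₂ α ≢ 0ℚ
      u     : ℚ
      α₀≡   : proj₁ α ≡ u * proj₂ α
      p∣u+z : p^ 1 ∣K (u , 1ℚ)

  -- If `p` divides the denominator of β₁, then 1 / β₁ is p-integral and multiplies β ∈ p ℤ_p into p
  -- ℤ_p. Otherwise β₁ is p-integral, so β₀ = 0 and the quotient is z itself.
  reduced : ∀ {α β} → Step α β → proj₂ α ≢ 0ℚ → Reduced β
  reduced {α} {β₀ , β₁} S α₁≢0 = cases (p ∣? ↧ₙ β₁)
    where
    open Step S
    β₁≢0 : β₁ ≢ 0ℚ
    β₁≢0 = irrational-step S α₁≢0
    instance _ = ≢-nonZero β₁≢0
    τ = 1/ β₁
    undo : ∀ v → τ * β₁ * v ≡ v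
    undo v = trans (cong (_* v) (*-inverseˡ β₁)) (*-identityˡ v)
    τ-int : p ∣ ↧ₙ β₁ → p^ 0 ∣ℚ τ
    τ-int p∣↧ = frac (↧ β₁) (↥ β₁) (λ p∣↥ → p∣↥⇒p∤↧ β₁ p∣↥ p∣↧) (begin
      τ * ℤ→ℚ (↥ β₁)             ≡⟨ cong (τ *_) (q*↧q≡↥q β₁) ⟨
      τ * (β₁ * ℤ→ℚ (↧ β₁))      ≡⟨ *-assoc τ β₁ (ℤ→ℚ (↧ β₁)) ⟨
      τ * β₁ * ℤ→ℚ (↧ β₁)        ≡⟨ cong (_* ℤ→ℚ (↧ β₁)) (*-inverseˡ β₁) ⟩
      1ℚ * ℤ→ℚ (↧ β₁)            ∎)
      where open ≡-Reasoning
    cases : Dec (p ∣ ↧ₙ β₁) → Reduced (β₀ , β₁)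
    cases (no p∤↧) = record
      { α₁≢0 = β₁≢0
      ; u = 0ℚ
      ; α₀≡ = trans (integral⇒β₀≡0 S (∣ℚ-↥↧ 0 β₁ p∤↧ (ℕ.1∣ _))) (sym (*-zeroˡ β₁))
      ; p∣u+z = 0 , λ k _ → subst (p^ 1 ∣ℚ_) (solve 1 (λ z → z := con 0ℚ :+ con 1ℚ :* z) refl (Zq k)) (p∣Zq k)
      }
    cases (yes p∣↧) = record
      { α₁≢0 = β₁≢0
      ; u = τ * β₀
      ; α₀≡ = trans (sym (undo β₀)) (solve 3 (λ τ β₁ β₀ → τ :* β₁ :* β₀ := τ :* β₀ :* β₁) refl τ β₁ β₀)
      ; p∣u+z = proj₁ p∣β , λ k k₀≤k → subst (p^ 1 ∣ℚ_)
          (trans (solve 4 (λ τ β₀ β₁ z → τ :* (β₀ :+ β₁ :* z) := τ :* β₀ :+ τ :* β₁ :* z) refl τ β₀ β₁ (Zq k))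
            (cong (λ v → τ * β₀ + v * Zq k) (*-inverseˡ β₁)))
          (∣ℚ-* (τ-int p∣↧) (proj₂ p∣β k k₀≤k))
      }

  -- From x α ∈ ℚ one gets x = x₁ (b + 2z − α / α₁), and the second factor is ≡ b modulo p.
  x₁-unit : ∀ {α β} → Reduced α → (S : Step α β) → Unit (proj₂ (Step.x S))
  x₁-unit {α₀ , α₁} R S = unit-cancel U-unit (subst Unit X≡x₁*U X-unit)
    where
    open Step S
    open Reduced R
    open ≡-Reasoning
    x₀ = proj₁ x
    x₁ = proj₂ x
    y₀ = proj₁ y
    y₁ = proj₂ y
    error = ∣ℚ-eventually 1 (x₁ * y₁)
    k₁ = proj₁ x-int ℕ.⊔ proj₁ y-int
    k₂ = proj₁ error ℕ.⊔ proj₁ p∣u+z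
    -- Enough digits of z for x, y, u + z and the error term x₁ y₁ r to show their divisibility at
    -- once.
    k = k₁ ℕ.⊔ k₂
    k₁≤k = ℕ.m≤m⊔n k₁ k₂
    k₂≤k = ℕ.m≤n⊔m k₁ k₂
    z = Zq k
    r = z * z + b * z + c
    U = b + (z + z - (u + 1ℚ * z))
    X-int : p^ 0 ∣ℚ eval k x
    X-int = proj₂ x-int k (ℕ.≤-trans (ℕ.m≤m⊔n _ _) k₁≤k)
    Y-int : p^ 0 ∣ℚ eval k y
    Y-int = proj₂ y-int k (ℕ.≤-trans (ℕ.m≤n⊔m (proj₁ x-int) _) k₁≤k)
    U-unit : Unit U
    U-unit = unit-+ (unit-↥↧ b p∤↥b p∤↧b) (∣ℚ-- (∣ℚ-+ (p∣Zq k) (p∣Zq k))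
      (proj₂ p∣u+z k (ℕ.≤-trans (ℕ.m≤n⊔m (proj₁ error) _) k₂≤k)))
    -- Evaluation at a truncation is multiplicative only up to x₁ y₁ r, where r is the value of the
    -- minimal polynomial there; r is divisible by `p ^ k`.
    X*Y : ε + x₁ * y₁ * r ≡ eval k x * eval k y
    X*Y = begin
      ε + x₁ * y₁ * r
        ≡⟨ solve 3 (λ e z t → e :+ t := e :+ con 0ℚ :* z :+ t) refl ε z (x₁ * y₁ * r) ⟩
      ε + 0ℚ * z + x₁ * y₁ * r
        ≡⟨ cong₂ (λ v w → v + w * z + x₁ * y₁ * r) (cong proj₁ x*y) (cong proj₂ x*y) ⟨
      (x₀ * y₀ - c * (x₁ * y₁)) + (x₀ * y₁ + x₁ * y₀ - b * (x₁ * y₁)) * z + x₁ * y₁ * r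
        ≡⟨ solve 7 (λ x₀ x₁ y₀ y₁ b c z →
             (x₀ :* y₀ :- c :* (x₁ :* y₁)) :+ (x₀ :* y₁ :+ x₁ :* y₀ :- b :* (x₁ :* y₁)) :* z :+ x₁ :* y₁ :* (z :* z :+ b :* z :+ c)
             := (x₀ :+ x₁ :* z) :* (y₀ :+ y₁ :* z)) refl x₀ x₁ y₀ y₁ b c z ⟩
      (x₀ + x₁ * z) * (y₀ + y₁ * z) ∎
    X-unit : Unit (eval k x)
    X-unit = unit-factorˡ X-int Y-int (subst Unit X*Y
      (unit-+ (sign-unit ε-sign) (proj₂ error (ℕ.≤-trans (ℕ.m≤m⊔n _ _) k₂≤k) (root-∣ℚ k))))
    -- The z-coordinate of x α = ρ ε, divided by α₁.
    relation : x₀ + x₁ * u - b * x₁ ≡ 0ℚ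
    relation = q*r≡0⇒r≡0 α₁≢0 (begin
      α₁ * (x₀ + x₁ * u - b * x₁)                 ≡⟨ solve 5 (λ a x₀ x₁ u b → a :* (x₀ :+ x₁ :* u :- b :* x₁) := x₀ :* a :+ x₁ :* (u :* a) :- b :* (x₁ :* a)) refl α₁ x₀ x₁ u b ⟩
      x₀ * α₁ + x₁ * (u * α₁) - b * (x₁ * α₁)     ≡⟨ cong (λ v → x₀ * α₁ + x₁ * v - b * (x₁ * α₁)) α₀≡ ⟨
      x₀ * α₁ + x₁ * α₀ - b * (x₁ * α₁)           ≡⟨ cong proj₂ x*α ⟩
      ρ * 0ℚ                                      ≡⟨ *-zeroʳ ρ ⟩
      0ℚ                                          ∎)
    X≡x₁*U : eval k x ≡ x₁ * U
    X≡x₁*U = begin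
      x₀ + x₁ * z
        ≡⟨ solve 5 (λ x₀ x₁ u b z → x₀ :+ x₁ :* z := x₁ :* (b :+ (z :+ z :- (u :+ con 1ℚ :* z))) :+ (x₀ :+ x₁ :* u :- b :* x₁)) refl x₀ x₁ u b z ⟩
      x₁ * U + (x₀ + x₁ * u - b * x₁)
        ≡⟨ cong (λ v → x₁ * U + v) relation ⟩
      x₁ * U + 0ℚ
        ≡⟨ +-identityʳ (x₁ * U) ⟩
      x₁ * U ∎

  β₁-unit : ∀ {α β} → Reduced α → Step α β → Unit (proj₂ β)
  β₁-unit R S = unit-cancel (unit-ℤ (+ a′) (largestCoprime⇒p∤ a′-largest)) (subst Unit (sym β₁*a′) (x₁-unit R S))
    where open Step S

  -- Arithmetic of steps between multiples of z.

  -- The step (0 , α₁) ↦ (0 , β₁) between rational multiples of z.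
  record Inverted (α₁ β₁ : ℚ) : Set where
    field
      y      : ℚ
      n      : ℕ
      y-unit : Unit y
      β₁*∣↥y∣ : β₁ * ℕ→ℚ ∣ ↥ y ∣ ≡ y
      c*y*α₁ : c * y * α₁ ≡ - (ℕ→ℚ (p ^ n) * ε)

  -- With α₀ = 0, the rational coordinate of x α = ρ ε is - c x₁ α₁ = ρ ε, and a′ is the whole
  -- numerator of the unit x₁.
  inverted : ∀ {α β} → Reduced α → proj₁ α ≡ 0ℚ → Unit (proj₂ α) → Step α β → Inverted (proj₂ α) (proj₂ β)
  inverted {α₀ , α₁} {β₀ , β₁} R α₀≡0 α₁-unit S = record
    { y = x₁
    ; n = proj₁ (exponent ρ-power)
    ; y-unit = x₁-unit R S
    ; β₁*∣↥y∣ = trans (cong (λ a → β₁ * ℕ→ℚ a) (sym (largestCoprime-unit (x₁-unit R S) a′-largest))) β₁*a′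
    ; c*y*α₁ = trans norm (cong (λ v → - (v * ε)) (proj₂ (exponent ρ-power)))
    }
    where
    open Step S
    open ≡-Reasoning
    x₀ = proj₁ x
    x₁ = proj₂ x
    norm : c * x₁ * α₁ ≡ - (ρ * ε)
    norm = begin
      c * x₁ * α₁                     ≡⟨ solve 4 (λ c x₀ x₁ a → c :* x₁ :* a := :- (x₀ :* con 0ℚ :- c :* (x₁ :* a))) refl c x₀ x₁ α₁ ⟩
      - (x₀ * 0ℚ - c * (x₁ * α₁))     ≡⟨ cong (λ v → - (x₀ * v - c * (x₁ * α₁))) α₀≡0 ⟨
      - (x₀ * α₀ - c * (x₁ * α₁))     ≡⟨ cong -_ (cong proj₁ x*α) ⟩
      - (ρ * ε)                       ∎
    c-int : p^ 0 ∣ℚ c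
    c-int = ∣ℚ-↥↧ 0 c p∤↧c (ℕ.1∣ _)
    exponent : IsPower ρ → Σ ℕ λ n → ρ ≡ ℕ→ℚ (p ^ n)
    exponent (inj₁ h) = h
    -- A negative exponent is impossible: clearing it would make the unit - ε divisible by `p`.
    exponent (inj₂ (n , ρ*P≡1)) = contradiction
      (∣ℚ-mono {1} (ℕ.s≤s ℕ.z≤n) (subst (p^ (suc n) ∣ℚ_) (begin
        c * x₁ * α₁ * P               ≡⟨ cong (_* P) norm ⟩
        - (ρ * ε) * P                 ≡⟨ solve 3 (λ ρ e P → :- (ρ :* e) :* P := :- (ρ :* P :* e)) refl ρ ε P ⟩
        - (ρ * P * ε)                 ≡⟨ cong (λ v → - (v * ε)) ρ*P≡1 ⟩
        - (1ℚ * ε)                    ≡⟨ cong -_ (*-identityˡ ε) ⟩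
        - ε                           ∎)
        (∣ℚ-* (∣ℚ-* (∣ℚ-* c-int (unit⇒∣ℚ (x₁-unit R S))) (unit⇒∣ℚ α₁-unit)) (∣ℚ-pow (suc n)))))
      (unit⇒p∤ℚ (sign-unit (sign-neg ε-sign)))
      where P = ℕ→ℚ (p ^ suc n)

  ∣↥c∣ = ∣ ↥ c ∣

  ∣↥y∣≢0 : ∀ {s t} (I : Inverted s t) → ℕ→ℚ ∣ ↥ Inverted.y I ∣ ≢ 0ℚ
  ∣↥y∣≢0 I = ℕ→ℚ≢0 _ λ eq → proj₁ (unit⇒p∤ (Inverted.y-unit I)) (subst (p ∣_) (sym eq) (p ℕ.∣0))

  -- Dividing y by the absolute value of its numerator leaves ±1 over its denominator.
  β₁*↧y-sign : ∀ {s t} (I : Inverted s t) → IsSign (t * ℕ→ℚ (↧ₙ (Inverted.y I)))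
  β₁*↧y-sign {t = t} I = subst IsSign σ≡ hσ
    where
    open Inverted I
    open ≡-Reasoning
    a = ℕ→ℚ ∣ ↥ y ∣
    e = ℕ→ℚ (↧ₙ y)
    σ = proj₁ (sign-∣∣ (↥ y))
    hσ = proj₁ (proj₂ (sign-∣∣ (↥ y)))
    σ≡ : σ ≡ t * e
    σ≡ = *-cancelʳ-≢0 (∣↥y∣≢0 I) (begin
      σ * a              ≡⟨ proj₂ (proj₂ (sign-∣∣ (↥ y))) ⟨
      ℤ→ℚ (↥ y)          ≡⟨ q*↧q≡↥q y ⟨
      y * e              ≡⟨ cong (_* e) β₁*∣↥y∣ ⟨
      t * a * e          ≡⟨ solve 3 (λ t a e → t :* a :* e := t :* e :* a) refl t a e ⟩
      t * e * a          ∎)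

  -- The absolute value of c y s = - pⁿ ε with denominators cleared, where s is ±1 over the
  -- denominator of the previous y.
  balance : ∀ {r s t} (I : Inverted r s) (J : Inverted s t) → let open Inverted in
    ∣↥c∣ ℕ.* ∣ ↥ y J ∣ ≡ ↧ₙ (y I) ℕ.* ↧ₙ (y J) ℕ.* ↧ₙ c ℕ.* p ^ n J
  balance {r} {s} {t} I J = signs-cancel
    (sign-* (sign-* (proj₁ (proj₂ sc)) (proj₁ (proj₂ sy))) (β₁*↧y-sign I))
    (sign-neg ε-sign) (begin
      σc * σy * (s * e) * ℕ→ℚ (∣↥c∣ ℕ.* ∣ ↥ y ∣)
        ≡⟨ cong (σc * σy * (s * e) *_) (ℕ→ℚ-homo-* ∣↥c∣ ∣ ↥ y ∣) ⟩
      σc * σy * (s * e) * (C * a)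
        ≡⟨ solve 6 (λ σ τ s e C a → σ :* τ :* (s :* e) :* (C :* a) := (σ :* C) :* (τ :* a) :* (s :* e)) refl σc σy s e C a ⟩
      (σc * C) * (σy * a) * (s * e)
        ≡⟨ cong₂ (λ v w → v * w * (s * e)) (trans (q*↧q≡↥q c) (proj₂ (proj₂ sc))) (trans (q*↧q≡↥q y) (proj₂ (proj₂ sy))) ⟨
      (c * D) * (y * e′) * (s * e)
        ≡⟨ solve 6 (λ c D y e′ s e → (c :* D) :* (y :* e′) :* (s :* e) := (c :* y :* s) :* (e :* e′ :* D)) refl c D y e′ s e ⟩
      (c * y * s) * (e * e′ * D)
        ≡⟨ cong (_* (e * e′ * D)) c*y*α₁ ⟩
      - (P * ε) * (e * e′ * D)
        ≡⟨ solve 3 (λ P ε v → :- (P :* ε) :* v := :- ε :* (v :* P)) refl P ε (e * e′ * D) ⟩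
      - ε * (e * e′ * D * P)
        ≡⟨ cong (- ε *_) homo ⟨
      - ε * ℕ→ℚ (eI ℕ.* ↧ₙ y ℕ.* ↧ₙ c ℕ.* p ^ n) ∎)
    where
    open Inverted J
    open ≡-Reasoning
    sc = sign-∣∣ (↥ c)
    sy = sign-∣∣ (↥ y)
    σc = proj₁ sc
    σy = proj₁ sy
    eI = ↧ₙ (Inverted.y I)
    e  = ℕ→ℚ eI
    e′ = ℕ→ℚ (↧ₙ y)
    C  = ℕ→ℚ ∣↥c∣
    a  = ℕ→ℚ ∣ ↥ y ∣
    D  = ℕ→ℚ (↧ₙ c)
    P  = ℕ→ℚ (p ^ n)
    homo : ℕ→ℚ (eI ℕ.* ↧ₙ y ℕ.* ↧ₙ c ℕ.* p ^ n) ≡ e * e′ * D * P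
    homo = trans (ℕ→ℚ-homo-* (eI ℕ.* ↧ₙ y ℕ.* ↧ₙ c) (p ^ n)) (cong (_* P)
      (trans (ℕ→ℚ-homo-* (eI ℕ.* ↧ₙ y) (↧ₙ c)) (cong (_* D) (ℕ→ℚ-homo-* eI (↧ₙ y)))))

  -- By `balance` the denominator of y divides the numerator of c times that of y, and it is coprime
  -- to the latter.
  ↧y∣↥c : ∀ {r s t} (I : Inverted r s) (J : Inverted s t) → ↧ₙ (Inverted.y J) ∣ ∣↥c∣
  ↧y∣↥c I J = coprime-divisor (Coprime.sym (↥↧-coprime y))
    (divides (eI ℕ.* (↧ₙ c ℕ.* p ^ n)) (trans (ℕ.*-comm ∣ ↥ y ∣ ∣↥c∣) (trans (balance I J)
      (ℕ-solve 4 (λ e e′ D P → e :*ℕ e′ :*ℕ D :*ℕ P :=ℕ e :*ℕ (D :*ℕ P) :*ℕ e′) refl eI (↧ₙ y) (↧ₙ c) (p ^ n)))))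
    where
    open Inverted J
    eI = ↧ₙ (Inverted.y I)

  -- Write the numerator of c as f e, with e the previous denominator. Cancelling e in `balance`
  -- gives f a = e′ pⁿ D, with D the denominator of c. Now a is coprime to e′ and to `p`, so a
  -- divides D; D is coprime to f, so D divides a.
  ∣↥y∣≡↧c : ∀ {r s t} (I : Inverted r s) (J : Inverted s t) →
            ↧ₙ (Inverted.y I) ∣ ∣↥c∣ → ∣ ↥ Inverted.y J ∣ ≡ ↧ₙ c
  ∣↥y∣≡↧c I J (divides f ∣↥c∣≡) = ℕ.∣-antisym a∣D D∣a
    where
    open Inverted J
    open ≡-Reasoning
    eI = ↧ₙ (Inverted.y I)
    a  = ∣ ↥ y ∣
    f*a : f ℕ.* a ≡ ↧ₙ y ℕ.* (p ^ n ℕ.* ↧ₙ c)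
    f*a = ℕ.*-cancelˡ-≡ _ _ eI (begin
      eI ℕ.* (f ℕ.* a)                          ≡⟨ ℕ-solve 3 (λ e f a → e :*ℕ (f :*ℕ a) :=ℕ f :*ℕ e :*ℕ a) refl eI f a ⟩
      f ℕ.* eI ℕ.* a                            ≡⟨ cong (ℕ._* a) ∣↥c∣≡ ⟨
      ∣↥c∣ ℕ.* a                                ≡⟨ balance I J ⟩
      eI ℕ.* ↧ₙ y ℕ.* ↧ₙ c ℕ.* p ^ n            ≡⟨ ℕ-solve 4 (λ e e′ D P → e :*ℕ e′ :*ℕ D :*ℕ P :=ℕ e :*ℕ (e′ :*ℕ (P :*ℕ D))) refl eI (↧ₙ y) (↧ₙ c) (p ^ n) ⟩
      eI ℕ.* (↧ₙ y ℕ.* (p ^ n ℕ.* ↧ₙ c))        ∎)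
    a∣D : a ∣ ↧ₙ c
    a∣D = coprime-divisor (Coprime.sym (p^k-coprime n (proj₁ (unit⇒p∤ y-unit))))
      (coprime-divisor (↥↧-coprime y) (divides f (sym f*a)))
    D∣a : ↧ₙ c ∣ a
    D∣a = coprime-divisor
      (λ (h , h′) → ↥↧-coprime c (ℕ.∣-trans h′ (divides eI (trans ∣↥c∣≡ (ℕ.*-comm f eI))) , h))
      (divides (↧ₙ y ℕ.* p ^ n) (trans f*a (sym (ℕ.*-assoc (↧ₙ y) (p ^ n) (↧ₙ c)))))

  ↥c-factors : ∀ {r s t} (I : Inverted r s) (J : Inverted s t) → ↧ₙ (Inverted.y I) ∣ ∣↥c∣ →
               ∣↥c∣ ≡ ↧ₙ (Inverted.y I) ℕ.* ↧ₙ (Inverted.y J) ℕ.* p ^ Inverted.n J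
  ↥c-factors I J h = ℕ.*-cancelʳ-≡ _ _ (↧ₙ c) (begin
    ∣↥c∣ ℕ.* ↧ₙ c                        ≡⟨ cong (∣↥c∣ ℕ.*_) (∣↥y∣≡↧c I J h) ⟨
    ∣↥c∣ ℕ.* ∣ ↥ y ∣                     ≡⟨ balance I J ⟩
    eI ℕ.* ↧ₙ y ℕ.* ↧ₙ c ℕ.* p ^ n       ≡⟨ ℕ-solve 4 (λ e e′ D P → e :*ℕ e′ :*ℕ D :*ℕ P :=ℕ e :*ℕ e′ :*ℕ P :*ℕ D) refl eI (↧ₙ y) (↧ₙ c) (p ^ n) ⟩
    eI ℕ.* ↧ₙ y ℕ.* p ^ n ℕ.* ↧ₙ c       ∎)
    where
    open Inverted J
    open ≡-Reasoning
    eI = ↧ₙ (Inverted.y I)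

  -- Once each y is D times the new coefficient, consecutive steps read c D t s = - pⁿ ε and c D u t
  -- = - pⁿ ε, so equal exponents give s = u. The two earlier steps supply the divisibility of the
  -- numerator of c.
  inverted-periodic : ∀ {q r s t u} → Inverted q r → Inverted r s → Inverted s t → Inverted t u → s ≡ u
  inverted-periodic {q} {r} {s} {t} {u} I₁ I₂ I₃ I₄ = *-cancelˡ-≢0 cDt≢0 (begin
    c * D * t * s              ≡⟨ solve 4 (λ c D t s → c :* D :* t :* s := c :* (t :* D) :* s) refl c D t s ⟩
    c * (t * D) * s            ≡⟨ cong (λ v → c * v * s) (scaled I₂ I₃ e₂∣) ⟩
    c * y I₃ * s               ≡⟨ c*y*α₁ I₃ ⟩
    - (ℕ→ℚ (p ^ n I₃) * ε)     ≡⟨ cong (λ m → - (ℕ→ℚ (p ^ m) * ε)) n₃≡n₄ ⟩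
    - (ℕ→ℚ (p ^ n I₄) * ε)     ≡⟨ c*y*α₁ I₄ ⟨
    c * y I₄ * t               ≡⟨ cong (λ v → c * v * t) (scaled I₃ I₄ e₃∣) ⟨
    c * (u * D) * t            ≡⟨ solve 4 (λ c D t u → c :* (u :* D) :* t := c :* D :* t :* u) refl c D t u ⟩
    c * D * t * u              ∎)
    where
    open Inverted
    open ≡-Reasoning
    D = ℕ→ℚ (↧ₙ c)
    e₂∣ = ↧y∣↥c I₁ I₂
    e₃∣ = ↧y∣↥c I₂ I₃
    scaled : ∀ {q r s} (I : Inverted q r) (J : Inverted r s) → ↧ₙ (y I) ∣ ∣↥c∣ → s * D ≡ y J
    scaled {s = s} I J h = trans (cong (λ a → s * ℕ→ℚ a) (sym (∣↥y∣≡↧c I J h))) (β₁*∣↥y∣ J)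
    -- Two factorisations of the numerator of c share the denominator of `y I₃`; what remains on
    -- each side is a number prime to `p` times a power of `p`.
    n₃≡n₄ : n I₃ ≡ n I₄
    n₃≡n₄ = exponents-equal (n I₃) (n I₄) (proj₂ (unit⇒p∤ (y-unit I₂))) (proj₂ (unit⇒p∤ (y-unit I₄)))
      (ℕ.*-cancelˡ-≡ _ _ (↧ₙ (y I₃)) (begin
        ↧ₙ (y I₃) ℕ.* (↧ₙ (y I₂) ℕ.* p ^ n I₃)      ≡⟨ ℕ-solve 3 (λ a b c → a :*ℕ (b :*ℕ c) :=ℕ b :*ℕ a :*ℕ c) refl (↧ₙ (y I₃)) (↧ₙ (y I₂)) (p ^ n I₃) ⟩
        ↧ₙ (y I₂) ℕ.* ↧ₙ (y I₃) ℕ.* p ^ n I₃        ≡⟨ ↥c-factors I₂ I₃ e₂∣ ⟨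
        ∣↥c∣                                        ≡⟨ ↥c-factors I₃ I₄ e₃∣ ⟩
        ↧ₙ (y I₃) ℕ.* ↧ₙ (y I₄) ℕ.* p ^ n I₄        ≡⟨ ℕ.*-assoc (↧ₙ (y I₃)) (↧ₙ (y I₄)) (p ^ n I₄) ⟩
        ↧ₙ (y I₃) ℕ.* (↧ₙ (y I₄) ℕ.* p ^ n I₄)      ∎))
    cDt≢0 : c * D * t ≢ 0ℚ
    cDt≢0 eq = *-≢0 (ℕ→ℚ≢0 (p ^ n I₃) (p^k≢0 (n I₃))) (sign≢0 ε-sign) (begin
      P * ε                    ≡⟨ solve 1 (λ v → v := :- (:- v)) refl (P * ε) ⟩
      - - (P * ε)              ≡⟨ cong -_ (c*y*α₁ I₃) ⟨
      - (c * y I₃ * s)         ≡⟨ cong (λ v → - (c * v * s)) (scaled I₂ I₃ e₂∣) ⟨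
      - (c * (t * D) * s)      ≡⟨ solve 4 (λ c D t s → :- (c :* (t :* D) :* s) := :- (c :* D :* t :* s)) refl c D t s ⟩
      - (c * D * t * s)        ≡⟨ cong (λ v → - (v * s)) eq ⟩
      - (0ℚ * s)               ≡⟨ solve 1 (λ s → :- (con 0ℚ :* s) := con 0ℚ) refl s ⟩
      0ℚ                       ∎)
      where P = ℕ→ℚ (p ^ n I₃)

  -- Finiteness and periodicity of expansions.

  module Expansion (T : K → K) (T-spec : ∀ α → TSpec α (T α)) where

    rational-finite : ∀ a → Σ ℕ λ m → iter T m (ι a) ≡ 0K
    rational-finite a = cases (a ≟ 0ℚ)
      where
      cases : Dec (a ≡ 0ℚ) → Σ ℕ λ m → iter T m (ι a) ≡ 0K
      cases (yes refl) = 0 , refl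
      cases (no a≢0)   = 1 , rational-step (step (λ eq → a≢0 (cong proj₁ eq)) (T-spec (ι a))) a≢0

    module _ (α : K) (α₁≢0 : proj₂ α ≢ 0ℚ) where

      nth : ℕ → K
      nth n = iter T n α

      nth-step : ∀ n → proj₂ (nth n) ≢ 0ℚ → Step (nth n) (nth (suc n))
      nth-step n h = step (λ eq → h (cong proj₂ eq)) (T-spec (nth n))

      nth-irrational : ∀ n → proj₂ (nth n) ≢ 0ℚ
      nth-irrational zero    = α₁≢0
      nth-irrational (suc n) = irrational-step (nth-step n (nth-irrational n)) (nth-irrational n)

      S : ∀ n → Step (nth n) (nth (suc n))
      S n = nth-step n (nth-irrational n)

      R : ∀ n → Reduced (nth (suc n))
      R n = reduced (S n) (nth-irrational n)

      -- The offset 2 arises because one step makes the element `Reduced` and a second makes its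
      -- coefficient a unit.
      nth-unit : ∀ n → Unit (proj₂ (nth (2 ℕ.+ n)))
      nth-unit n = β₁-unit (R n) (S (suc n))

      nth-zero : ∀ n → proj₁ (nth (2 ℕ.+ n)) ≡ 0ℚ
      nth-zero n = integral⇒β₀≡0 (S (suc n)) (unit⇒∣ℚ (nth-unit n))

      nth-inverted : ∀ n → Inverted (proj₂ (nth (2 ℕ.+ n))) (proj₂ (nth (3 ℕ.+ n)))
      nth-inverted n = inverted (R (suc n)) (nth-zero n) (nth-unit n) (S (2 ℕ.+ n))

      -- Multiples of z begin at index 2, and `inverted-periodic` needs two steps before its first
      -- compared coefficient: the chain 2, 3, 4, 5, 6 compares indices 4 and 6.
      irrational-periodic : iter T 4 α ≡ iter T 6 α
      irrational-periodic = cong₂ _,_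
        (trans (nth-zero 2) (sym (nth-zero 4)))
        (inverted-periodic (nth-inverted 0) (nth-inverted 1) (nth-inverted 2) (nth-inverted 3))

theorem2 : (p : ℕ) → Prime p → (b c : ℚ) → (d : ℕ → ℕ) → (ε : ℚ) →
    Setup.PIntegral p b c d ε b → Setup.PIntegral p b c d ε c →
    ¬ (p ∣ ∣ ↥ b ∣) → p ∣ ∣ ↥ c ∣ →
    IrreducibleQuad b c →
    (∀ n → d n < p) → d 0 ≡ 0 →
    Setup.IsRoot p b c d ε →
    (ε ≡ 1ℚ ⊎ ε ≡ - 1ℚ) →
    (T : K → K) → (∀ α → Setup.TSpec p b c d ε α (T α)) →
    ((a : ℚ) → Σ ℕ λ m → iter T m (ι a) ≡ 0K) ×
    ((α : K) → proj₂ α ≢ 0ℚ →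
    Σ ℕ λ m₁ → Σ ℕ λ m₂ → (m₁ < m₂) × (iter T m₁ α ≡ iter T m₂ α))
theorem2 p p-prime b c d ε p∤↧b p∤↧c p∤↥b _ _ _ d₀≡0 root ε-sign T T-spec =
  rational-finite , λ α α₁≢0 → 4 , 6 , ℕ.s≤s (ℕ.s≤s (ℕ.s≤s (ℕ.s≤s (ℕ.s≤s ℕ.z≤n)))) , irrational-periodic α α₁≢0
  where open Algorithm.Expansion p p-prime b c d ε p∤↧b p∤↧c p∤↥b d₀≡0 root ε-sign T T-spec
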